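{- Let $p\geq 2$ and let $G$ be a finite simple $\{pK_2, \mathrm{gem}\}$-free graph. Then $\chi(G)\leq f_p(\omega(G))$, where the functions $f_p:\mathbb{N}\to\mathbb{N}$ ($p\geq 2$) are defined by: $f_t(1)=1$ for all $t\geq 2$; $f_2(2)=3$; $f_2(m)=m$ for $m\geq 3$; $f_p(2)=2p-2$ for $p\geq 3$; and $f_p(m)=f_{p-1}(m)+2m-2$ for $p,m\geq 3$.
   Context: $\chi(G)$ is the chromatic number and $\omega(G)$ the clique number of $G$. $pK_2$ is the disjoint union of $p$ edges. The gem is the graph obtained from the path $P_4$ on four vertices by adding a vertex adjacent to all four of its vertices (i.e. $K_1+P_4$). A graph is $\mathcal{F}$-free if it has no induced subgraph isomorphic to a member of $\mathcal{F}$. -}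

module Defs where

open import Data.Nat using (ℕ; zero; suc; _+_; _*_; _∸_; _≤_; _/_)
open import Data.Nat using (_≡ᵇ_)
open import Data.Empty using (⊥)
open import Data.Fin using (Fin; toℕ; _≟_)
open import Data.Bool using (Bool; true; false; _∧_; not)
open import Data.Product using (Σ; _×_; ∃)
open import Relation.Binary.PropositionalEquality using (_≡_; _≢_)
open import Relation.Nullary.Decidable using (⌊_⌋)
open import Function.Definitions using (Injective)

record Graph (n : ℕ) : Set where
  field
    adj    : Fin n → Fin n → Bool
    sym    : ∀ u v → adj u v ≡ adj v u
    irrefl : ∀ v → adj v v ≡ false
open Graph public

ContainsInduced : ∀ {n} → Graph n → (k : ℕ) → (Fin k → Fin k → Bool) → Set
ContainsInduced {n} G k H =
  Σ (Fin k → Fin n) λ f → Injective _≡_ _≡_ f × (∀ i j → H i j ≡ adj G (f i) (f j))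

-- pK₂ on vertex set Fin (p * 2): vertices i ≠ j are adjacent iff
-- ⌊i/2⌋ = ⌊j/2⌋ (so the edges are {0,1}, {2,3}, …).
pK₂ : (p : ℕ) → Fin (p * 2) → Fin (p * 2) → Bool
pK₂ p i j = not ⌊ i ≟ j ⌋ ∧ ((toℕ i / 2) ≡ᵇ (toℕ j / 2))

-- The gem K₁ + P₄ on Fin 5: path 0-1-2-3, vertex 4 adjacent to 0,1,2,3.
gemℕ : ℕ → ℕ → Bool
gemℕ 0 1 = true
gemℕ 1 0 = true
gemℕ 1 2 = true
gemℕ 2 1 = true
gemℕ 2 3 = true
gemℕ 3 2 = true
gemℕ 4 0 = true
gemℕ 4 1 = true
gemℕ 4 2 = true
gemℕ 4 3 = true
gemℕ 0 4 = true
gemℕ 1 4 = true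
gemℕ 2 4 = true
gemℕ 3 4 = true
gemℕ _ _ = false

gem : Fin 5 → Fin 5 → Bool
gem i j = gemℕ (toℕ i) (toℕ j)

PK₂GemFree : ∀ {n} → ℕ → Graph n → Set
PK₂GemFree p G = (ContainsInduced G (p * 2) (pK₂ p) → ⊥)
                 × (ContainsInduced G 5 gem → ⊥)

Clique : ∀ {n} → Graph n → ℕ → Set
Clique {n} G k = Σ (Fin k → Fin n) λ f →
  Injective _≡_ _≡_ f × (∀ i j → i ≢ j → adj G (f i) (f j) ≡ true)

IsCliqueNumber : ∀ {n} → Graph n → ℕ → Set
IsCliqueNumber G w = Clique G w × (∀ k → Clique G k → k ≤ w)

-- A proper colouring with k colours; χ(G) ≤ k iff G is k-colourable.
Colourable : ∀ {n} → Graph n → ℕ → Set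
Colourable {n} G k = Σ (Fin n → Fin k) λ c →
  ∀ u v → adj G u v ≡ true → c u ≢ c v

-- f p m  =  f_p(m). Values for p < 2 and m = 0 are irrelevant conventions.
f : ℕ → ℕ → ℕ
f p 0 = 0
f p 1 = 1
f 0 _ = 0
f 1 _ = 0
f 2 2 = 3
f 2 (suc (suc (suc m))) = 3 + m
f (suc (suc (suc p))) 2 = 2 * (3 + p) ∸ 2
f (suc (suc (suc p))) (suc (suc (suc m))) =
  f (suc (suc p)) (3 + m) + (2 * (3 + m) ∸ 2)

{-# OPTIONS --safe #-}
-- For an edge xy, N(x) and N(y) induce P₄-free graphs, which are (ω − 1)-colourable, and the
-- vertices adjacent to neither of x, y induce a (p − 1)K₂-free graph.  This gives the recursion
-- f_p(m) = f_{p-1}(m) + 2(m − 1) and leaves two base cases.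
--
-- p = 2, ω ≥ 3.  If N(u) ⊆ N(v) for non-adjacent u ≠ v, delete u and colour it like v; a universal
-- vertex leaves a P₄-free graph.  Otherwise every edge of the complement is the middle edge of an
-- induced P₄ of the complement, and extending such a path yields an induced C₅ or C₆ there.
-- Classifying the vertices by their neighbours on that cycle gives a 3-colouring.
--
-- p = 3, ω = 2.  The vertices adjacent to neither x nor y induce a bipartite graph, and then N(x)
-- and N(y) supply two further colours, or a blown-up C₅ with classes A₀, …, A₄ together with a set
-- I of isolated vertices.  In the latter case let Pᵣ consist of the vertices of N(x) with
-- neighbours in both Aᵣ₋₁ and Aᵣ₊₁.  If no edge joins Pᵣ to a vertex of I with a neighbour in
-- N(y), then Aᵣ, Pᵣ and I share a colour, N(y) has its own, and the rest of N(x) fits into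
-- Aᵣ₊₁ ∪ Aᵣ₊₃ and Aᵣ₊₂ ∪ Aᵣ₊₄.  Such edges cannot exist for all five r.
module Submission where

open import Defs
open import Data.Nat using (ℕ; _≤_)

open import Data.Bool using (Bool; true; false; T; _∧_; not)
import Data.Bool.Properties as Bool
open import Data.Empty using (⊥; ⊥-elim)
open import Data.Fin using (Fin; zero; suc; toℕ; fromℕ<; _≟_)
open import Data.Fin.Patterns using (0F; 1F; 2F; 3F; 4F)
open import Data.Fin.Properties as Fin using (toℕ<n; toℕ-injective; toℕ-fromℕ<)
open import Data.List using (List; []; _∷_; length; lookup; map; filter; allFin; upTo)
open import Data.List.Properties using (filter-notAll)
open import Data.List.Membership.Propositional using (_∈_; _∉_; find; lose)
open import Data.List.Membership.Propositional.Properties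
  using (∈-filter⁺; ∈-filter⁻; ∈-allFin; ∈-lookup)
open import Data.List.Relation.Unary.All as All using (All; []; _∷_; all?)
open import Data.List.Relation.Unary.AllPairs using (AllPairs; []; _∷_)
open import Data.List.Relation.Unary.Any using (here; there; any?)
open import Data.Maybe using (Maybe; just; nothing; is-just; _<∣>_)
open import Data.Nat as ℕ using (zero; suc; _+_; _*_; _∸_; _/_; _<_; z≤n; s≤s)
open import Data.Nat.DivMod using (m/n≡1+[m∸n]/n)
open import Data.Nat.Induction using (<-wellFounded)
open import Data.Nat.Properties
  using (≤-trans; <-≤-trans; <-irrefl; <-cmp; m≤m+n; +-monoʳ-<; +-cancelˡ-≡; +-suc; +-comm;
         +-assoc; +-identityʳ)
open import Data.Product using (Σ; ∃; _×_; _,_; proj₁; proj₂)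
open import Data.Sum using (_⊎_; inj₁; inj₂)
open import Data.Unit using (⊤; tt)
open import Function using (_∘_)
open import Function.Definitions using (Injective)
open import Induction.WellFounded using (Acc; acc)
open import Relation.Binary.Definitions using (tri<; tri≈; tri>)
open import Relation.Binary.PropositionalEquality
  using (_≡_; _≢_; refl; trans; subst; cong) renaming (sym to ≡-sym)
open import Relation.Nullary using (Dec; yes; no; ¬_; ¬?; contradiction)
open import Relation.Nullary.Decidable using (_×-dec_; _→-dec_; map′; toWitness)
open import Relation.Unary using (Decidable)

-- Refutation by exhaustive case distinction

-- Row i of a pattern lists the adjacencies of vertex i to the vertices i − 1, …, 0, in this order.
Pattern : Set
Pattern = List (List Bool)

K₃-pattern 2K₂-pattern 3K₂-pattern C₅-pattern gem-pattern : Pattern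
K₃-pattern  = [] ∷ (true ∷ []) ∷ (true ∷ true ∷ []) ∷ []
2K₂-pattern = [] ∷ (true ∷ []) ∷ (false ∷ false ∷ []) ∷ (true ∷ false ∷ false ∷ []) ∷ []
3K₂-pattern = [] ∷ (true ∷ []) ∷ (false ∷ false ∷ []) ∷ (true ∷ false ∷ false ∷ []) ∷
  (false ∷ false ∷ false ∷ false ∷ []) ∷ (true ∷ false ∷ false ∷ false ∷ false ∷ []) ∷ []
-- The vertices are listed along the complement of C₅, which is again C₅.
C₅-pattern  = [] ∷ (false ∷ []) ∷ (false ∷ true ∷ []) ∷ (false ∷ true ∷ true ∷ []) ∷
  (false ∷ true ∷ true ∷ false ∷ []) ∷ []
-- The vertex of degree four comes first.
gem-pattern = [] ∷ (true ∷ []) ∷ (true ∷ true ∷ []) ∷ (true ∷ false ∷ true ∷ []) ∷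
  (true ∷ false ∷ false ∷ true ∷ []) ∷ []

-- A literal (i , j , b) says that the vertices named i and j are adjacent (b = true) or not.
Literal : Set
Literal = ℕ × ℕ × Bool

Table : Set
Table = List (List (Maybe Bool))

update : {A : Set} → A → ℕ → (A → A) → List A → List A
update d zero    f []       = f d ∷ []
update d zero    f (x ∷ xs) = f x ∷ xs
update d (suc i) f []       = d ∷ update d i f []
update d (suc i) f (x ∷ xs) = x ∷ update d i f xs

insert : ℕ → ℕ → Bool → Table → Table
insert i j b tb = put i j (put j i tb)
  where
  put : ℕ → ℕ → Table → Table
  put k l = update [] k (update nothing l λ _ → just b)

table : List Literal → Table
table []                = []
table ((i , j , b) ∷ K) = insert i j b (table K)

at : {A : Set} → A → List A → ℕ → A
at d []       _       = d
at d (x ∷ xs) zero    = x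
at d (x ∷ xs) (suc i) = at d xs i

_agrees_ : Maybe Bool → Bool → Bool
nothing    agrees b     = false
just true  agrees b     = b
just false agrees true  = false
just false agrees false = true

fits : List (Maybe Bool) → List Bool → List ℕ → Bool
fits r []       js       = true
fits r (b ∷ bs) []       = false
fits r (b ∷ bs) (j ∷ js) = (at nothing r j agrees b) ∧ fits r bs js

-- Finds a copy of the pattern without any proof; `extends` below certifies it afterwards.  This
-- is much faster than a search that carries the proofs along.
embedding : Table → List ℕ → Pattern → List ℕ → Maybe (List ℕ)
embedding tb names []           js = just []
embedding tb names (row ∷ rows) js = try names tb
  where
  -- The names and the rows of the table advance in step, since the names are 0, 1, 2, ... in order.
  try : List ℕ → Table → Maybe (List ℕ)
  try []       _        = nothing
  try (i ∷ is) []       = nothing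
  try (i ∷ is) (r ∷ rs) with fits r row js
  ... | false = try is rs
  ... | true  with embedding tb names rows (i ∷ js)
  ...   | just ks = just (i ∷ ks)
  ...   | nothing = try is rs

module Refutation {V : Set} (e : V → V → Bool)
  (e-sym : ∀ u v → e u v ≡ e v u) where

  Joined : V → List Bool → List V → Set
  Joined v []       us       = ⊤
  Joined v (b ∷ bs) []       = ⊥
  Joined v (b ∷ bs) (u ∷ us) = e v u ≡ b × Joined v bs us

  -- Distinctness is not part of the definition. In each pattern above any two vertices have
  -- different neighbourhoods, so a copy in a loopless graph has distinct vertices anyway.
  Extends : Pattern → List V → Set
  Extends []           us = ⊤
  Extends (row ∷ rows) us = Σ V λ v → Joined v row us × Extends rows (v ∷ us)

  Free : Pattern → Set
  Free pat = ¬ Extends pat []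

  -- The index records the literals, so that a chain of facts determines the closed data on which
  -- the search computes.
  data Facts (ρ : ℕ → V) : List Literal → Set where
    []        : Facts ρ []
    _—_∶_⨾_ : ∀ i j {b K} → e (ρ i) (ρ j) ≡ b → Facts ρ K → Facts ρ ((i , j , b) ∷ K)

  infixr 5 _—_∶_⨾_

  module Search (ρ : ℕ → V) where

    known : ∀ K i j b → Maybe (Facts ρ K → e (ρ i) (ρ j) ≡ b)
    known [] i j b = nothing
    known ((k , l , a) ∷ K) i j b = first <∣> later
      where
      later : Maybe (Facts ρ ((k , l , a) ∷ K) → e (ρ i) (ρ j) ≡ b)
      later with known K i j b
      ... | just f  = just λ { (_ — _ ∶ _ ⨾ fs) → f fs }
      ... | nothing = nothing
      first : Maybe (Facts ρ ((k , l , a) ∷ K) → e (ρ i) (ρ j) ≡ b)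
      first with a Bool.≟ b
      ... | no _ = nothing
      ... | yes refl with i ℕ.≟ k | j ℕ.≟ l
      ...   | yes refl | yes refl = just λ { (_ — _ ∶ p ⨾ _) → p }
      ...   | yes _    | no _     = nothing
      ...   | no _     | _        with i ℕ.≟ l | j ℕ.≟ k
      ...     | yes refl | yes refl = just λ { (_ — _ ∶ p ⨾ _) → trans (e-sym _ _) p }
      ...     | yes _    | no _     = nothing
      ...     | no _     | _        = nothing

    joined : ∀ K i row js → Maybe (Facts ρ K → Joined (ρ i) row (map ρ js))
    joined K i []       js       = just λ _ → tt
    joined K i (b ∷ bs) []       = nothing
    joined K i (b ∷ bs) (j ∷ js) with known K i j b
    ... | nothing = nothing
    ... | just f  with joined K i bs js
    ...   | nothing = nothing
    ...   | just g  = just λ fs → f fs , g fs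

    extends : ∀ K pat (is js : List ℕ) → Maybe (Facts ρ K → Extends pat (map ρ js))
    extends K []           is       js = just λ _ → tt
    extends K (row ∷ rows) []       js = nothing
    extends K (row ∷ rows) (i ∷ is) js with joined K i row js
    ... | nothing = nothing
    ... | just f  with extends K rows is (i ∷ js)
    ...   | nothing = nothing
    ...   | just g  = just λ fs → ρ i , f fs , g fs

    module _ (names : List ℕ) (forbidden : List (Σ Pattern Free)) where

      violated : ∀ K → Table → List (Σ Pattern Free) → Maybe (Facts ρ K → ⊥)
      violated K tb [] = nothing
      violated K tb ((pat , free) ∷ pats) with embedding tb names pat []
      ... | nothing = violated K tb pats
      ... | just is with extends K pat is []
      ...   | just f  = just λ fs → free (f fs)
      ...   | nothing = nothing

      -- Branches on the pairs in the list until a forbidden pattern shows up.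
      refute : ∀ K → Table → List (ℕ × ℕ) → Maybe (Facts ρ K → ⊥)
      refute K tb splits = violated K tb forbidden <∣> cases splits
        where
        cases : List (ℕ × ℕ) → Maybe (Facts ρ K → ⊥)
        cases [] = nothing
        cases ((i , j) ∷ rest) with at nothing (at [] tb i) j
        ... | just _  = cases rest
        ... | nothing with refute ((i , j , true) ∷ K) (insert i j true tb) rest
        ...   | nothing = nothing
        ...   | just f with refute ((i , j , false) ∷ K) (insert i j false tb) rest
        ...     | nothing = nothing
        ...     | just g = just λ fs → branch fs (e (ρ i) (ρ j)) refl
          where
          branch : Facts ρ K → ∀ b → e (ρ i) (ρ j) ≡ b → ⊥
          branch fs true  eq = f (i — j ∶ eq ⨾ fs)
          branch fs false eq = g (i — j ∶ eq ⨾ fs)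

  -- The head doubles as the default value, which makes the naming total; `names` lists only the
  -- genuine indices.
  env : V → List V → ℕ → V
  env v vs = at v (v ∷ vs)

  names : List V → List ℕ
  names vs = upTo (length vs)

  module _ (forbidden : List (Σ Pattern Free)) where

    -- The implicit argument reduces to `⊤` exactly if the search succeeds, so the case distinction
    -- is carried out during type checking.
    absurd : ∀ v vs {K} (splits : List (ℕ × ℕ)) → let open Search (env v vs) in
      {_ : T (is-just (refute (names (v ∷ vs)) forbidden K (table K) splits))} → Facts (env v vs) K → ⊥
    absurd v vs {K} splits {ok} with Search.refute (env v vs) (names (v ∷ vs)) forbidden K (table K) splits
    ... | just f = f

    derive : ∀ v vs i j b {K} (splits : List (ℕ × ℕ)) → let open Search (env v vs) in
      {_ : T (is-just (refute (names (v ∷ vs)) forbidden ((i , j , not b) ∷ K)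
                              (table ((i , j , not b) ∷ K)) splits))} →
      Facts (env v vs) K → e (env v vs i) (env v vs j) ≡ b
    derive v vs i j b splits {ok} fs with e (env v vs i) (env v vs j) in eq
    derive v vs i j true  splits {ok} fs | true  = refl
    derive v vs i j true  splits {ok} fs | false = ⊥-elim (absurd v vs splits {ok} (i — j ∶ eq ⨾ fs))
    derive v vs i j false splits {ok} fs | true  = ⊥-elim (absurd v vs splits {ok} (i — j ∶ eq ⨾ fs))
    derive v vs i j false splits {ok} fs | false = refl

-- 2K₂- and gem-free graphs

module Pentagon {V : Set} (e : V → V → Bool)
  (e-sym : ∀ u v → e u v ≡ e v u) where
  open Refutation e e-sym

  -- v₀, …, v₄ is an induced 5-cycle of the complement, in this order.
  record Pent (v₀ v₁ v₂ v₃ v₄ : V) : Set where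
    constructor mk
    field
      n01 : e v₀ v₁ ≡ false
      n12 : e v₁ v₂ ≡ false
      n23 : e v₂ v₃ ≡ false
      n34 : e v₃ v₄ ≡ false
      n40 : e v₄ v₀ ≡ false
      a02 : e v₀ v₂ ≡ true
      a13 : e v₁ v₃ ≡ true
      a24 : e v₂ v₄ ≡ true
      a30 : e v₃ v₀ ≡ true
      a41 : e v₄ v₁ ≡ true

  rotate : ∀ {v₀ v₁ v₂ v₃ v₄} → Pent v₀ v₁ v₂ v₃ v₄ → Pent v₁ v₂ v₃ v₄ v₀
  rotate (mk a b c d e f g h i j) = mk b c d e a g h i j f

  3Colourable : Set
  3Colourable = Σ (V → Fin 3) λ c → ∀ u v → e u v ≡ true → c u ≢ c v

  module _ (2K₂-free : Free 2K₂-pattern) (gem-free : Free gem-pattern)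
    (search : {P : V → Set} → (∀ v → Dec (P v)) → Dec (∃ P))
    -- Non-adjacent distinct vertices have incomparable neighbourhoods; `s` certifies that `u` and
    -- `v` are distinct.
    (reduced : ∀ u v s → e u v ≡ false → e s u ≡ true → e s v ≡ false →
               ∃ λ r → e r v ≡ true × e r u ≡ false) where
    forbidden : List (Σ Pattern Free)
    forbidden = (2K₂-pattern , 2K₂-free) ∷ (gem-pattern , gem-free) ∷ []

    -- A vertex either has no neighbour on the pentagon (class Z), or is non-adjacent exactly to
    -- vᵢ₋₁, vᵢ, vᵢ₊₁ (class Aᵢ), or is non-adjacent exactly to vᵢ, vᵢ₊₁ (class Bᵢ).
    B : (v₀ v₁ v₂ v₃ v₄ u : V) → Set
    B v₀ v₁ v₂ v₃ v₄ u =
      e u v₀ ≡ false × e u v₁ ≡ false × e u v₂ ≡ true × e u v₃ ≡ true × e u v₄ ≡ true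

    B? : ∀ v₀ v₁ v₂ v₃ v₄ → Dec (∃ (B v₀ v₁ v₂ v₃ v₄))
    B? v₀ v₁ v₂ v₃ v₄ = search λ u → (e u v₀ Bool.≟ false) ×-dec (e u v₁ Bool.≟ false) ×-dec
       (e u v₂ Bool.≟ true) ×-dec (e u v₃ Bool.≟ true) ×-dec (e u v₄ Bool.≟ true)

    module _ {v₀ v₁ v₂ v₃ v₄ : V} (pent : Pent v₀ v₁ v₂ v₃ v₄) where
      open Pent pent

      base : ∀ {vs K} → Facts (env v₀ (v₁ ∷ v₂ ∷ v₃ ∷ v₄ ∷ vs)) K →
             Facts (env v₀ (v₁ ∷ v₂ ∷ v₃ ∷ v₄ ∷ vs)) _
      base fs = 0 — 1 ∶ n01 ⨾ 1 — 2 ∶ n12 ⨾ 2 — 3 ∶ n23 ⨾ 3 — 4 ∶ n34 ⨾ 4 — 0 ∶ n40 ⨾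
                0 — 2 ∶ a02 ⨾ 1 — 3 ∶ a13 ⨾ 2 — 4 ∶ a24 ⨾ 3 — 0 ∶ a30 ⨾ 4 — 1 ∶ a41 ⨾ fs

      -- Some `s` is adjacent to `v₀` but not to `b`. Avoiding 2K₂ and the gem forces `s` to be
      -- adjacent to `b′`, `v₄`, `v₃` and `v₂`, and then `v₃ v₀ v₂ v₄` is a P₄ in N(`s`).
      B-stable : ∀ {b b′} → B v₀ v₁ v₂ v₃ v₄ b → B v₀ v₁ v₂ v₃ v₄ b′ → e b b′ ≡ true → ⊥
      B-stable {b} {b′} (b₀ , b₁ , b₂ , b₃ , b₄) (b₀′ , b₁′ , b₂′ , b₃′ , b₄′) bb
        with s , s₀ , sb ← reduced b v₀ b′ b₀ (trans (e-sym b′ b) bb) b₀′ =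
        absurd forbidden v₀ (v₁ ∷ v₂ ∷ v₃ ∷ v₄ ∷ b ∷ b′ ∷ s ∷ [])
          ((7 , 1) ∷ (7 , 2) ∷ (7 , 3) ∷ (7 , 4) ∷ (7 , 6) ∷ [])
        (base (5 — 0 ∶ b₀ ⨾ 5 — 1 ∶ b₁ ⨾ 5 — 2 ∶ b₂ ⨾ 5 — 3 ∶ b₃ ⨾ 5 — 4 ∶ b₄ ⨾
          6 — 0 ∶ b₀′ ⨾ 6 — 1 ∶ b₁′ ⨾ 6 — 2 ∶ b₂′ ⨾ 6 — 3 ∶ b₃′ ⨾ 6 — 4 ∶ b₄′ ⨾
          5 — 6 ∶ bb ⨾ 7 — 0 ∶ s₀ ⨾ 7 — 5 ∶ sb ⨾ []))

      -- If `b` and `c` are adjacent, then `v₁ c b v₂` is a P₄ in N(`v₄`); otherwise `b v₂` and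
      -- `c v₁` form a 2K₂.
      B-gap : ∀ {b c} → B v₀ v₁ v₂ v₃ v₄ b → B v₂ v₃ v₄ v₀ v₁ c → ⊥
      B-gap {b} {c} (b₀ , b₁ , b₂ , b₃ , b₄) (c₂ , c₃ , c₄ , c₀ , c₁) =
        absurd forbidden v₀ (v₁ ∷ v₂ ∷ v₃ ∷ v₄ ∷ b ∷ c ∷ []) ((5 , 6) ∷ [])
        (base (5 — 0 ∶ b₀ ⨾ 5 — 1 ∶ b₁ ⨾ 5 — 2 ∶ b₂ ⨾ 5 — 3 ∶ b₃ ⨾ 5 — 4 ∶ b₄ ⨾
          6 — 0 ∶ c₀ ⨾ 6 — 1 ∶ c₁ ⨾ 6 — 2 ∶ c₂ ⨾ 6 — 3 ∶ c₃ ⨾ 6 — 4 ∶ c₄ ⨾ []))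

    module _ {v₀ v₁ v₂ v₃ v₄ : V} (pent : Pent v₀ v₁ v₂ v₃ v₄)
             (noB₃ : ¬ ∃ (B v₃ v₄ v₀ v₁ v₂)) (noB₄ : ¬ ∃ (B v₄ v₀ v₁ v₂ v₃))
             (noB₀ : ¬ ∃ (B v₀ v₁ v₂ v₃ v₄)) where

      -- The colour classes are Z ∪ A₀ ∪ A₁, A₃ ∪ A₄ and A₂ ∪ B₁ ∪ B₂.
      pick : Bool → Bool → Bool → Fin 3
      pick g₀    true  true  = 2F
      pick g₀    true  false = 1F
      pick true  false g₄    = 2F
      pick false false g₄    = 0F

      -- With B₀, B₃ and B₄ empty, the adjacencies to `v₀`, `v₁` and `v₄` tell the three colour
      -- classes apart.
      colour : V → Fin 3
      colour u = pick (e u v₀) (e u v₁) (e u v₄)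

      A₀∪A₁∪Z : ∀ u → e u v₀ ≡ false → e u v₁ ≡ false → e u v₄ ≡ false ⊎ e u v₂ ≡ false
      A₀∪A₁∪Z u u₀ u₁ with e u v₄ in u₄ | e u v₂ in u₂
      ... | false | _     = inj₁ refl
      ... | true  | false = inj₂ refl
      ... | true  | true  = ⊥-elim (noB₀ (u , u₀ , u₁ , u₂ ,
        derive forbidden v₀ (v₁ ∷ v₂ ∷ v₃ ∷ v₄ ∷ u ∷ []) 5 3 true []
          (base pent (5 — 0 ∶ u₀ ⨾ 5 — 1 ∶ u₁ ⨾ 5 — 2 ∶ u₂ ⨾ 5 — 4 ∶ u₄ ⨾ [])) , u₄))

      -- A vertex `s` adjacent to `v₀` but not to `u` exists by `reduced`, and it would lie in the
      -- empty class B₃.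
      A₀-A₁ : ∀ u w → e u v₀ ≡ false → e u v₁ ≡ false → e u v₄ ≡ false →
        e w v₀ ≡ false → e w v₁ ≡ false → e w v₂ ≡ false → e u w ≡ true → ⊥
      A₀-A₁ u w u₀ u₁ u₄ w₀ w₁ w₂ uw
        with s , s₀ , su ← reduced u v₀ w u₀ (trans (e-sym w u) uw) w₀ =
        noB₃ (s , derive forbidden v₀ rest 7 3 false splits facts ,
              derive forbidden v₀ rest 7 4 false splits facts ,
              s₀ , derive forbidden v₀ rest 7 1 true splits facts ,
              derive forbidden v₀ rest 7 2 true splits facts)
        where
        rest : List V
        rest = v₁ ∷ v₂ ∷ v₃ ∷ v₄ ∷ u ∷ w ∷ s ∷ []
        splits : List (ℕ × ℕ)
        splits = (5 , 2) ∷ (5 , 3) ∷ (6 , 4) ∷ (6 , 3) ∷ (7 , 1) ∷ (7 , 2) ∷ (7 , 3) ∷ (7 , 4) ∷ (7 , 6) ∷ []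
        facts : Facts (env v₀ rest) _
        facts = base pent (5 — 0 ∶ u₀ ⨾ 5 — 1 ∶ u₁ ⨾ 5 — 4 ∶ u₄ ⨾ 6 — 0 ∶ w₀ ⨾ 6 — 1 ∶ w₁ ⨾ 6 — 2 ∶ w₂ ⨾
                      5 — 6 ∶ uw ⨾ 7 — 0 ∶ s₀ ⨾ 7 — 5 ∶ su ⨾ [])

      A₃∪A₄ : ∀ u → e u v₁ ≡ true → e u v₄ ≡ false → e u v₂ ≡ false ⊎ (e u v₀ ≡ false × e u v₃ ≡ false)
      A₃∪A₄ u u₁ u₄ with e u v₂ in u₂ | e u v₀ in u₀ | e u v₃ in u₃
      ... | false | _     | _     = inj₁ refl
      ... | true  | false | false = inj₂ (refl , refl)
      ... | true  | false | true  = ⊥-elim (noB₄ (u , u₄ , u₀ , u₁ , u₂ , u₃))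
      ... | true  | true  | false = ⊥-elim (noB₃ (u , u₃ , u₄ , u₀ , u₁ , u₂))
      -- Four vertices of the pentagon induce a P₄, so a vertex complete to it yields a gem.
      ... | true  | true  | true  = ⊥-elim (absurd forbidden v₀ (v₁ ∷ v₂ ∷ v₃ ∷ v₄ ∷ u ∷ []) []
          (base pent (5 — 0 ∶ u₀ ⨾ 5 — 1 ∶ u₁ ⨾ 5 — 2 ∶ u₂ ⨾ 5 — 3 ∶ u₃ ⨾ 5 — 4 ∶ u₄ ⨾ [])))

      -- Here a vertex `s` adjacent to `v₄` but not to `u` would lie in the empty class B₀.
      A₄-A₃ : ∀ u w → e u v₁ ≡ true → e u v₄ ≡ false → e u v₀ ≡ false → e u v₃ ≡ false →
        e w v₁ ≡ true → e w v₄ ≡ false → e w v₂ ≡ false → e u w ≡ true → ⊥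
      A₄-A₃ u w u₁ u₄ u₀ u₃ w₁ w₄ w₂ uw
        with s , s₄ , su ← reduced u v₄ w u₄ (trans (e-sym w u) uw) w₄ =
        noB₀ (s , derive forbidden v₀ rest 7 0 false splits facts ,
              derive forbidden v₀ rest 7 1 false splits facts ,
              derive forbidden v₀ rest 7 2 true splits facts ,
              derive forbidden v₀ rest 7 3 true splits facts , s₄)
        where
        rest : List V
        rest = v₁ ∷ v₂ ∷ v₃ ∷ v₄ ∷ u ∷ w ∷ s ∷ []
        splits : List (ℕ × ℕ)
        splits = (5 , 2) ∷ (6 , 0) ∷ (6 , 3) ∷ (7 , 3) ∷ (7 , 2) ∷ (7 , 1) ∷ (7 , 0) ∷ (7 , 6) ∷ []
        facts : Facts (env v₀ rest) _
        facts = base pent (5 — 0 ∶ u₀ ⨾ 5 — 1 ∶ u₁ ⨾ 5 — 3 ∶ u₃ ⨾ 5 — 4 ∶ u₄ ⨾ 6 — 1 ∶ w₁ ⨾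
          6 — 2 ∶ w₂ ⨾ 6 — 4 ∶ w₄ ⨾
                      5 — 6 ∶ uw ⨾ 7 — 4 ∶ s₄ ⨾ 7 — 5 ∶ su ⨾ [])

      proper : ∀ u w → e u w ≡ true → colour u ≢ colour w
      -- The six adjacencies that decide the colours are generalised together with their equations,
      -- so that `clash` can match on them.
      proper u w uw = clash _ _ _ _ _ _ refl refl refl refl refl refl
        where
        rest : List V
        rest = v₁ ∷ v₂ ∷ v₃ ∷ v₄ ∷ u ∷ w ∷ []

        wu : e w u ≡ true
        wu = trans (e-sym w u) uw

        -- Among the classes Z, Aᵢ and Bᵢ only B₂ is joined to both `v₁` and `v₄`.
        B₂-bits : ∀ u → e u v₁ ≡ true → e u v₄ ≡ true → B v₂ v₃ v₄ v₀ v₁ u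
        B₂-bits u u₁ u₄ = derive forbidden v₀ _ 5 2 false splits facts ,
                          derive forbidden v₀ _ 5 3 false splits facts ,
                          u₄ , derive forbidden v₀ _ 5 0 true splits facts , u₁
          where
          splits : List (ℕ × ℕ)
          splits = (5 , 0) ∷ (5 , 2) ∷ (5 , 3) ∷ []
          facts : Facts (env v₀ (v₁ ∷ v₂ ∷ v₃ ∷ v₄ ∷ u ∷ [])) _
          facts = base pent (5 — 1 ∶ u₁ ⨾ 5 — 4 ∶ u₄ ⨾ [])

        B₁-bits : ∀ u → e u v₀ ≡ true → e u v₁ ≡ false → e u v₃ ≡ true → B v₁ v₂ v₃ v₄ v₀ u
        B₁-bits u u₀ u₁ u₃ = u₁ , derive forbidden v₀ _ 5 2 false splits facts , u₃ ,
                             derive forbidden v₀ _ 5 4 true splits facts , u₀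
          where
          splits : List (ℕ × ℕ)
          splits = (5 , 2) ∷ (5 , 4) ∷ []
          facts : Facts (env v₀ (v₁ ∷ v₂ ∷ v₃ ∷ v₄ ∷ u ∷ [])) _
          facts = base pent (5 — 0 ∶ u₀ ⨾ 5 — 1 ∶ u₁ ⨾ 5 — 3 ∶ u₃ ⨾ [])

        clash : ∀ a b c a′ b′ c′ → e u v₀ ≡ a → e u v₁ ≡ b → e u v₄ ≡ c →
                e w v₀ ≡ a′ → e w v₁ ≡ b′ → e w v₄ ≡ c′ → pick a b c ≢ pick a′ b′ c′
        clash false false _ false false _ u₀ u₁ _ w₀ w₁ _ _ with A₀∪A₁∪Z u u₀ u₁ | A₀∪A₁∪Z w w₀ w₁
        ... | inj₁ u₄ | inj₂ w₂ = A₀-A₁ u w u₀ u₁ u₄ w₀ w₁ w₂ uw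
        ... | inj₂ u₂ | inj₁ w₄ = A₀-A₁ w u w₀ w₁ w₄ u₀ u₁ u₂ wu
        ... | inj₁ u₄ | inj₁ w₄ = absurd forbidden v₀ rest ((5 , 2) ∷ (5 , 3) ∷ (6 , 2) ∷ (6 , 3) ∷ [])
          (base pent (5 — 0 ∶ u₀ ⨾ 5 — 1 ∶ u₁ ⨾ 5 — 4 ∶ u₄ ⨾ 6 — 0 ∶ w₀ ⨾ 6 — 1 ∶ w₁ ⨾
            6 — 4 ∶ w₄ ⨾ 5 — 6 ∶ uw ⨾ []))
        ... | inj₂ u₂ | inj₂ w₂ = absurd forbidden v₀ rest ((5 , 4) ∷ (5 , 3) ∷ (6 , 4) ∷ (6 , 3) ∷ [])
          (base pent (5 — 0 ∶ u₀ ⨾ 5 — 1 ∶ u₁ ⨾ 5 — 2 ∶ u₂ ⨾ 6 — 0 ∶ w₀ ⨾ 6 — 1 ∶ w₁ ⨾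
            6 — 2 ∶ w₂ ⨾ 5 — 6 ∶ uw ⨾ []))
        clash _ true false _ true false _ u₁ u₄ _ w₁ w₄ _ with A₃∪A₄ u u₁ u₄ | A₃∪A₄ w w₁ w₄
        ... | inj₂ (u₀ , u₃) | inj₁ w₂ = A₄-A₃ u w u₁ u₄ u₀ u₃ w₁ w₄ w₂ uw
        ... | inj₁ u₂ | inj₂ (w₀ , w₃) = A₄-A₃ w u w₁ w₄ w₀ w₃ u₁ u₄ u₂ wu
        ... | inj₁ u₂ | inj₁ w₂ = absurd forbidden v₀ rest ((5 , 0) ∷ (5 , 3) ∷ (6 , 0) ∷ (6 , 3) ∷ [])
          (base pent (5 — 1 ∶ u₁ ⨾ 5 — 2 ∶ u₂ ⨾ 5 — 4 ∶ u₄ ⨾ 6 — 1 ∶ w₁ ⨾ 6 — 2 ∶ w₂ ⨾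
            6 — 4 ∶ w₄ ⨾ 5 — 6 ∶ uw ⨾ []))
        ... | inj₂ (u₀ , u₃) | inj₂ (w₀ , w₃) = absurd forbidden v₀ rest ((5 , 2) ∷ (6 , 2) ∷ [])
          (base pent (5 — 0 ∶ u₀ ⨾ 5 — 1 ∶ u₁ ⨾ 5 — 3 ∶ u₃ ⨾ 5 — 4 ∶ u₄ ⨾
                 6 — 0 ∶ w₀ ⨾ 6 — 1 ∶ w₁ ⨾ 6 — 3 ∶ w₃ ⨾ 6 — 4 ∶ w₄ ⨾ 5 — 6 ∶ uw ⨾ []))
        clash _ true true _ true true _ u₁ u₄ _ w₁ w₄ _ =
          B-stable (rotate (rotate pent)) (B₂-bits u u₁ u₄) (B₂-bits w w₁ w₄) uw
        clash true false _ true false _ u₀ u₁ _ w₀ w₁ _ _ with e u v₃ in u₃ | e w v₃ in w₃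
        ... | true | true = B-stable (rotate pent) (B₁-bits u u₀ u₁ u₃) (B₁-bits w w₀ w₁ w₃) uw
        ... | false | _ = absurd forbidden v₀ rest ((5 , 2) ∷ (5 , 4) ∷ (6 , 2) ∷ (6 , 4) ∷ (6 , 3) ∷ [])
          (base pent (5 — 0 ∶ u₀ ⨾ 5 — 1 ∶ u₁ ⨾ 5 — 3 ∶ u₃ ⨾ 6 — 0 ∶ w₀ ⨾ 6 — 1 ∶ w₁ ⨾ 5 — 6 ∶ uw ⨾ []))
        ... | true | false = absurd forbidden v₀ rest ((5 , 2) ∷ (5 , 4) ∷ (6 , 2) ∷ (6 , 4) ∷ [])
          (base pent (5 — 0 ∶ u₀ ⨾ 5 — 1 ∶ u₁ ⨾ 5 — 3 ∶ u₃ ⨾ 6 — 0 ∶ w₀ ⨾ 6 — 1 ∶ w₁ ⨾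
            6 — 3 ∶ w₃ ⨾ 5 — 6 ∶ uw ⨾ []))
        clash true false _ _ true true u₀ u₁ _ _ w₁ w₄ _ = absurd forbidden v₀ rest
          ((5 , 2) ∷ (5 , 3) ∷ (5 , 4) ∷ (6 , 0) ∷ (6 , 2) ∷ (6 , 3) ∷ [])
          (base pent (5 — 0 ∶ u₀ ⨾ 5 — 1 ∶ u₁ ⨾ 6 — 1 ∶ w₁ ⨾ 6 — 4 ∶ w₄ ⨾ 5 — 6 ∶ uw ⨾ []))
        clash _ true true true false _ _ u₁ u₄ w₀ w₁ _ _ = absurd forbidden v₀ rest
          ((6 , 2) ∷ (6 , 3) ∷ (6 , 4) ∷ (5 , 0) ∷ (5 , 2) ∷ (5 , 3) ∷ [])
          (base pent (6 — 0 ∶ w₀ ⨾ 6 — 1 ∶ w₁ ⨾ 5 — 1 ∶ u₁ ⨾ 5 — 4 ∶ u₄ ⨾ 5 — 6 ∶ uw ⨾ []))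
        clash false false _ _ true true _ _ _ _ _ _ ()
        clash false false _ _ true false _ _ _ _ _ _ ()
        clash false false _ true false _ _ _ _ _ _ _ ()
        clash true false _ _ true false _ _ _ _ _ _ ()
        clash true false _ false false _ _ _ _ _ _ _ ()
        clash _ true true _ true false _ _ _ _ _ _ ()
        clash _ true true false false _ _ _ _ _ _ _ ()
        clash _ true false _ true true _ _ _ _ _ _ ()
        clash _ true false false false _ _ _ _ _ _ _ ()
        clash _ true false true false _ _ _ _ _ _ _ ()

      3-colouring : 3Colourable
      3-colouring = colour , proper

    -- At most two of the classes Bᵢ are inhabited, and they are consecutive.
    pentagon-3-colourable : ∀ {v₀ v₁ v₂ v₃ v₄} → Pent v₀ v₁ v₂ v₃ v₄ → 3Colourable
    pentagon-3-colourable {v₀} {v₁} {v₂} {v₃} {v₄} pent₀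
      with B? v₀ v₁ v₂ v₃ v₄ | B? v₁ v₂ v₃ v₄ v₀ | B? v₂ v₃ v₄ v₀ v₁
    -- In each case the pentagon is rotated so that three consecutive empty classes take the places
    -- of B₃, B₄ and B₀.
    ... | yes (_ , b₀) | yes (_ , b₁) | _ = 3-colouring pent₄
            (λ (_ , b) → B-gap pent₀ b₀ b) (λ (_ , b) → B-gap pent₃ b b₀) (λ (_ , b) → B-gap pent₄ b b₁)
      where
      pent₃ = rotate (rotate (rotate pent₀))
      pent₄ = rotate pent₃
    ... | yes (_ , b₀) | no no₁ | _ = 3-colouring (rotate (rotate (rotate pent₀)))
            no₁ (λ (_ , b) → B-gap pent₀ b₀ b) (λ (_ , b) → B-gap (rotate (rotate (rotate pent₀))) b b₀)
    ... | no no₀ | yes (_ , b₁) | _ = 3-colouring pent₀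
            (λ (_ , b) → B-gap (rotate pent₀) b₁ b)
            (λ (_ , b) → B-gap (rotate (rotate (rotate (rotate pent₀)))) b b₁) no₀
    ... | no no₀ | no no₁ | yes (_ , b₂) = 3-colouring (rotate pent₀)
            (λ (_ , b) → B-gap (rotate (rotate pent₀)) b₂ b) no₀ no₁
    ... | no no₀ | no no₁ | no no₂ = 3-colouring (rotate (rotate pent₀)) no₀ no₁ no₂

-- An induced hexagon in the complement

module Hexagon {V : Set} (e : V → V → Bool)
  (e-sym : ∀ u v → e u v ≡ e v u) where
  open Refutation e e-sym
  open Pentagon e e-sym

  module _ (2K₂-free : Free 2K₂-pattern) (gem-free : Free gem-pattern) (C₅-free : Free C₅-pattern) where

    forbidden₆ : List (Σ Pattern Free)
    forbidden₆ = (2K₂-pattern , 2K₂-free) ∷ (C₅-pattern , C₅-free) ∷ (gem-pattern , gem-free) ∷ []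

    module _ (v₀ v₁ v₂ v₃ v₄ v₅ : V)
      (n01 : e v₀ v₁ ≡ false) (n12 : e v₁ v₂ ≡ false) (n23 : e v₂ v₃ ≡ false)
      (n34 : e v₃ v₄ ≡ false) (n45 : e v₄ v₅ ≡ false) (n50 : e v₅ v₀ ≡ false)
      (a02 : e v₀ v₂ ≡ true) (a13 : e v₁ v₃ ≡ true) (a24 : e v₂ v₄ ≡ true)
      (a35 : e v₃ v₅ ≡ true) (a40 : e v₄ v₀ ≡ true) (a51 : e v₅ v₁ ≡ true)
      (a03 : e v₀ v₃ ≡ true) (a14 : e v₁ v₄ ≡ true) (a25 : e v₂ v₅ ≡ true) where

      -- With Tᵢ the class of the vertices non-adjacent exactly to vᵢ₋₁, vᵢ, vᵢ₊₁ and U that of the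
      -- vertices without neighbours on the hexagon, the colour classes are U ∪ T₀ ∪ T₁, T₂ ∪ T₃
      -- and T₄ ∪ T₅.
      hex-pick : Bool → Bool → Bool → Fin 3
      hex-pick g₀    true  true  = 0F
      hex-pick g₀    true  false = 2F
      hex-pick true  false g₄    = 1F
      hex-pick false false g₄    = 0F

      hex-proper : ∀ u w → e u w ≡ true →
        hex-pick (e u v₀) (e u v₂) (e u v₄) ≢ hex-pick (e w v₀) (e w v₂) (e w v₄)
      hex-proper u w uw = clash _ _ _ _ _ _ refl refl refl refl refl refl
        where
        rest : List V
        rest = v₁ ∷ v₂ ∷ v₃ ∷ v₄ ∷ v₅ ∷ u ∷ w ∷ []
        splits : List (ℕ × ℕ)
        -- All adjacencies of `u` and `w` to the hexagon are tried; if the two colours agree, the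
        -- edge `u w` always completes a forbidden subgraph.
        splits = (6 , 0) ∷ (6 , 1) ∷ (6 , 2) ∷ (6 , 3) ∷ (6 , 4) ∷ (6 , 5) ∷
                 (7 , 0) ∷ (7 , 1) ∷ (7 , 2) ∷ (7 , 3) ∷ (7 , 4) ∷ (7 , 5) ∷ []
        hex : ∀ {K} → Facts (env v₀ rest) K → Facts (env v₀ rest) _
        hex fs = 0 — 1 ∶ n01 ⨾ 1 — 2 ∶ n12 ⨾ 2 — 3 ∶ n23 ⨾ 3 — 4 ∶ n34 ⨾ 4 — 5 ∶ n45 ⨾ 5 — 0 ∶ n50 ⨾
                 0 — 2 ∶ a02 ⨾ 1 — 3 ∶ a13 ⨾ 2 — 4 ∶ a24 ⨾ 3 — 5 ∶ a35 ⨾ 4 — 0 ∶ a40 ⨾ 5 — 1 ∶ a51 ⨾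
                 0 — 3 ∶ a03 ⨾ 1 — 4 ∶ a14 ⨾ 2 — 5 ∶ a25 ⨾ 6 — 7 ∶ uw ⨾ fs
        clash : ∀ a b c a′ b′ c′ → e u v₀ ≡ a → e u v₂ ≡ b → e u v₄ ≡ c →
                e w v₀ ≡ a′ → e w v₂ ≡ b′ → e w v₄ ≡ c′ → hex-pick a b c ≢ hex-pick a′ b′ c′
        clash _ true true _ true true u₀ u₂ u₄ w₀ w₂ w₄ _ = absurd forbidden₆ v₀ rest splits
          (hex (6 — 2 ∶ u₂ ⨾ 6 — 4 ∶ u₄ ⨾ 7 — 2 ∶ w₂ ⨾ 7 — 4 ∶ w₄ ⨾ []))
        clash _ true true false false _ u₀ u₂ u₄ w₀ w₂ w₄ _ = absurd forbidden₆ v₀ rest splits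
          (hex (6 — 2 ∶ u₂ ⨾ 6 — 4 ∶ u₄ ⨾ 7 — 2 ∶ w₂ ⨾ 7 — 0 ∶ w₀ ⨾ []))
        clash false false _ _ true true u₀ u₂ u₄ w₀ w₂ w₄ _ = absurd forbidden₆ v₀ rest splits
          (hex (6 — 2 ∶ u₂ ⨾ 6 — 0 ∶ u₀ ⨾ 7 — 2 ∶ w₂ ⨾ 7 — 4 ∶ w₄ ⨾ []))
        clash false false _ false false _ u₀ u₂ u₄ w₀ w₂ w₄ _ = absurd forbidden₆ v₀ rest splits
          (hex (6 — 2 ∶ u₂ ⨾ 6 — 0 ∶ u₀ ⨾ 7 — 2 ∶ w₂ ⨾ 7 — 0 ∶ w₀ ⨾ []))
        clash _ true false _ true false u₀ u₂ u₄ w₀ w₂ w₄ _ = absurd forbidden₆ v₀ rest splits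
          (hex (6 — 2 ∶ u₂ ⨾ 6 — 4 ∶ u₄ ⨾ 7 — 2 ∶ w₂ ⨾ 7 — 4 ∶ w₄ ⨾ []))
        clash true false _ true false _ u₀ u₂ u₄ w₀ w₂ w₄ _ = absurd forbidden₆ v₀ rest splits
          (hex (6 — 2 ∶ u₂ ⨾ 6 — 0 ∶ u₀ ⨾ 7 — 2 ∶ w₂ ⨾ 7 — 0 ∶ w₀ ⨾ []))
        clash false false _ _ true false _ _ _ _ _ _ ()
        clash false false _ true false _ _ _ _ _ _ _ ()
        clash true false _ _ true true _ _ _ _ _ _ ()
        clash true false _ _ true false _ _ _ _ _ _ ()
        clash true false _ false false _ _ _ _ _ _ _ ()
        clash _ true true _ true false _ _ _ _ _ _ ()
        clash _ true true true false _ _ _ _ _ _ _ ()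
        clash _ true false _ true true _ _ _ _ _ _ ()
        clash _ true false false false _ _ _ _ _ _ _ ()
        clash _ true false true false _ _ _ _ _ _ _ ()

      hexagon-3-colourable : 3Colourable
      hexagon-3-colourable = (λ u → hex-pick (e u v₀) (e u v₂) (e u v₄)) , hex-proper

  module _ (2K₂-free : Free 2K₂-pattern) (gem-free : Free gem-pattern)
    (search : {P : V → Set} → (∀ v → Dec (P v)) → Dec (∃ P))
    (reduced : ∀ u v s → e u v ≡ false → e s u ≡ true → e s v ≡ false →
               ∃ λ r → e r v ≡ true × e r u ≡ false) where

    joined? : ∀ v row us → Dec (Joined v row us)
    joined? v []       us       = yes _
    joined? v (b ∷ bs) []       = no λ ()
    joined? v (b ∷ bs) (u ∷ us) = (e v u Bool.≟ b) ×-dec joined? v bs us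

    extends? : ∀ pat us → Dec (Extends pat us)
    extends? []           us = yes _
    extends? (row ∷ rows) us = search λ v → joined? v row us ×-dec extends? rows (v ∷ us)

    -- In the complement a b c d is an induced path, and every edge is the middle edge of one.
    -- Prolonging a b c d twice beyond a closes up to a C₅ or a C₆.
    reduced-3-colourable : ∀ {a b c d} → e b c ≡ false → e a b ≡ false → e a c ≡ true →
      e d b ≡ true → e d c ≡ false → 3Colourable
    reduced-3-colourable {a} {b} {c} {d} bc ab ac db dc with extends? C₅-pattern []
    ... | yes (v₀ , _ , v₁ , (p10 , _) , v₂ , (p21 , p20 , _) , v₃ , (p32 , p31 , p30 , _) ,
               v₄ , (p43 , p42 , p41 , p40 , _) , _) =
      pentagon-3-colourable 2K₂-free gem-free search reduced
        (mk (flip p10) (flip p21) (flip p32) (flip p43) p40 (flip p20) (flip p31) (flip p42) p30 p41)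
      where
      flip : ∀ {u v b} → e u v ≡ b → e v u ≡ b
      flip = trans (e-sym _ _)
    ... | no C₅-free
      with a′ , a′b , a′a ← reduced a b c ab (trans (e-sym c a) ac) (trans (e-sym c b) bc)
      with a″ , a″a , a″a′ ← reduced a′ a b a′a (trans (e-sym b a′) a′b) (trans (e-sym b a) ab) =
      hexagon-3-colourable 2K₂-free gem-free C₅-free a″ a′ a b c d
        a″a′ a′a ab bc (trans (e-sym c d) dc)
        -- The first derived non-edge joins `d` to `a″` in the complement and closes the hexagon;
        -- the other derivations exclude its chords.
        (derive F a″ rest 5 0 false splits facts) a″a a′b ac (trans (e-sym b d) db)
        (derive F a″ rest 4 0 true splits facts) (derive F a″ rest 5 1 true splits facts)
        (derive F a″ rest 0 3 true splits facts) (derive F a″ rest 1 4 true splits facts)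
        (derive F a″ rest 2 5 true splits facts)
      where
      F = forbidden₆ 2K₂-free gem-free C₅-free
      rest = a′ ∷ a ∷ b ∷ c ∷ d ∷ []
      splits = (1 , 4) ∷ (2 , 5) ∷ (1 , 5) ∷ (0 , 3) ∷ (0 , 4) ∷ []
      facts : Facts (env a″ rest) _
      facts = 0 — 1 ∶ a″a′ ⨾ 1 — 2 ∶ a′a ⨾ 2 — 3 ∶ ab ⨾ 3 — 4 ∶ bc ⨾ 5 — 4 ∶ dc ⨾
              0 — 2 ∶ a″a ⨾ 1 — 3 ∶ a′b ⨾ 2 — 4 ∶ ac ⨾ 5 — 3 ∶ db ⨾ []

-- Triangle-free graphs without 3K₂

module TriangleFree {V : Set} (e : V → V → Bool) (e-sym : ∀ u v → e u v ≡ e v u) where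
  open Refutation e e-sym

  module _ (K₃-free : Free K₃-pattern) (3K₂-free : Free 3K₂-pattern) {x y : V} (xy : e x y ≡ true) where

    forbidden : List (Σ Pattern Free)
    forbidden = (K₃-pattern , K₃-free) ∷ (3K₂-pattern , 3K₂-free) ∷ []

    flip : ∀ {u v b} → e u v ≡ b → e v u ≡ b
    flip = trans (e-sym _ _)

    triangle : ∀ {a b c} → e a b ≡ true → e a c ≡ true → e b c ≡ true → ⊥
    triangle ab ac bc = K₃-free (_ , _ , _ , (flip ab , _) , _ , (flip bc , flip ac , _) , _)

    apart : ∀ {a b c} → e a b ≡ true → e a c ≡ true → e b c ≡ false
    apart {a} {b} {c} ab ac with e b c in bc
    ... | true  = ⊥-elim (triangle ab ac bc)
    ... | false = refl

    infix 4 _∼_ _≁_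
    _∼_ _≁_ : V → V → Set
    u ∼ v = e u v ≡ true
    u ≁ v = e u v ≡ false

    record Far (u : V) : Set where
      constructor far
      field
        ≁x : x ≁ u
        ≁y : y ≁ u
    open Far

    -- A chord of a 5-cycle closes a triangle, so the non-edges are consequences and are supplied by
    -- `base`.
    record Hole (v₀ v₁ v₂ v₃ v₄ : V) : Set where
      constructor hole
      field
        f₀ : Far v₀
        f₁ : Far v₁
        f₂ : Far v₂
        f₃ : Far v₃
        f₄ : Far v₄
        v₀₁ : v₀ ∼ v₁
        v₁₂ : v₁ ∼ v₂
        v₂₃ : v₂ ∼ v₃
        v₃₄ : v₃ ∼ v₄
        v₄₀ : v₄ ∼ v₀

    rotate : ∀ {v₀ v₁ v₂ v₃ v₄} → Hole v₀ v₁ v₂ v₃ v₄ → Hole v₁ v₂ v₃ v₄ v₀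
    rotate (hole a b c d e f g h i j) = hole b c d e a g h i j f

    -- The class Aᵢ of the blown-up 5-cycle is Class vᵢ₋₁ vᵢ₊₁.
    record Class (v v′ a : V) : Set where
      constructor class
      field
        distant : Far a
        left    : v ∼ a
        right   : v′ ∼ a

    record Isolated (v₀ v₁ v₂ v₃ v₄ w : V) : Set where
      constructor isolated
      field
        distant : Far w
        w₀ : w ≁ v₀
        w₁ : w ≁ v₁
        w₂ : w ≁ v₂
        w₃ : w ≁ v₃
        w₄ : w ≁ v₄

    module _ {v₀ v₁ v₂ v₃ v₄ : V} (h : Hole v₀ v₁ v₂ v₃ v₄) where
      open Hole h

      base : ∀ {vs K} → Facts (env x (y ∷ v₀ ∷ v₁ ∷ v₂ ∷ v₃ ∷ v₄ ∷ vs)) K →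
             Facts (env x (y ∷ v₀ ∷ v₁ ∷ v₂ ∷ v₃ ∷ v₄ ∷ vs)) _
      base fs = 0 — 1 ∶ xy ⨾ 2 — 3 ∶ v₀₁ ⨾ 3 — 4 ∶ v₁₂ ⨾ 4 — 5 ∶ v₂₃ ⨾ 5 — 6 ∶ v₃₄ ⨾ 6 — 2 ∶ v₄₀ ⨾
        0 — 2 ∶ ≁x f₀ ⨾ 0 — 3 ∶ ≁x f₁ ⨾ 0 — 4 ∶ ≁x f₂ ⨾ 0 — 5 ∶ ≁x f₃ ⨾ 0 — 6 ∶ ≁x f₄ ⨾
        1 — 2 ∶ ≁y f₀ ⨾ 1 — 3 ∶ ≁y f₁ ⨾ 1 — 4 ∶ ≁y f₂ ⨾ 1 — 5 ∶ ≁y f₃ ⨾ 1 — 6 ∶ ≁y f₄ ⨾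
        2 — 4 ∶ apart (flip v₀₁) v₁₂ ⨾ 3 — 5 ∶ apart (flip v₁₂) v₂₃ ⨾ 4 — 6 ∶ apart (flip v₂₃) v₃₄ ⨾
        5 — 2 ∶ apart (flip v₃₄) v₄₀ ⨾ 6 — 3 ∶ apart (flip v₄₀) v₀₁ ⨾ fs

      -- Otherwise `{x y, a v₄, b v₂}` is a 3K₂: edges `a v₂` and `b v₄` would close triangles with
      -- `v₁` and `v₀`.
      complete : ∀ {a b} → Class v₄ v₁ a → Class v₀ v₂ b → a ∼ b
      complete {a} {b} (class (far xa ya) 4a 1a) (class (far xb yb) 0b 2b) =
        derive forbidden x (y ∷ v₀ ∷ v₁ ∷ v₂ ∷ v₃ ∷ v₄ ∷ a ∷ b ∷ []) 7 8 true ((7 , 4) ∷ (8 , 6) ∷ [])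
          (base (0 — 7 ∶ xa ⨾ 1 — 7 ∶ ya ⨾ 6 — 7 ∶ 4a ⨾ 3 — 7 ∶ 1a ⨾
                 0 — 8 ∶ xb ⨾ 1 — 8 ∶ yb ⨾ 2 — 8 ∶ 0b ⨾ 4 — 8 ∶ 2b ⨾ []))

      -- The neighbours of `a` on the hole are pairwise non-adjacent, so some edge of the hole has
      -- both ends non-adjacent to `a`. With `x y` and an edge `w a` it would form a 3K₂.
      isolated-apart : ∀ {w a} → Isolated v₀ v₁ v₂ v₃ v₄ w → Far a → w ≁ a
      isolated-apart {w} {a} (isolated (far xw yw) w₀ w₁ w₂ w₃ w₄) (far xa ya) =
        derive forbidden x (y ∷ v₀ ∷ v₁ ∷ v₂ ∷ v₃ ∷ v₄ ∷ w ∷ a ∷ []) 7 8 false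
          ((8 , 2) ∷ (8 , 3) ∷ (8 , 4) ∷ (8 , 5) ∷ (8 , 6) ∷ [])
          (base (0 — 7 ∶ xw ⨾ 1 — 7 ∶ yw ⨾ 0 — 8 ∶ xa ⨾ 1 — 8 ∶ ya ⨾
                 7 — 2 ∶ w₀ ⨾ 7 — 3 ∶ w₁ ⨾ 7 — 4 ∶ w₂ ⨾ 7 — 5 ∶ w₃ ⨾ 7 — 6 ∶ w₄ ⨾ []))

    -- A vertex `w` of I with a neighbour in N(`y`). Stating isolation through `w-apart` keeps the
    -- record independent of the hole, so one anchor serves all rotations.
    record Anchor : Set where
      field
        {w q}   : V
        w-far   : Far w
        w-apart : ∀ {a} → Far a → w ≁ a
        yq      : y ∼ q
        wq      : w ∼ q

    -- p ∈ P₀ with an edge to a vertex of I that has a neighbour in N(y); c ∈ A₄ and d ∈ A₁.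
    record Spoke (v₀ v₁ v₂ v₃ v₄ : V) : Set where
      field
        {p c d} : V
        xp      : x ∼ p
        c∈      : Class v₃ v₀ c
        d∈      : Class v₀ v₂ d
        pc      : p ∼ c
        pd      : p ∼ d
        anchor  : Anchor
        wp      : Anchor.w anchor ∼ p

    open Class using (distant; left; right)

    cases : ∀ u v → u ∼ v ⊎ u ≁ v
    cases u v with e u v
    ... | true  = inj₁ refl
    ... | false = inj₂ refl

    decided : ∀ {u v} → (u ≁ v → ⊥) → u ∼ v
    decided {u} {v} f with e u v
    ... | true  = refl
    ... | false = ⊥-elim (f refl)

    -- Incompatibility of five spokes

    module _ {v₀ v₁ v₂ v₃ v₄ : V} (h : Hole v₀ v₁ v₂ v₃ v₄) where
      private
        h₁ = rotate h
        h₂ = rotate h₁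
        h₃ = rotate h₂
        h₄ = rotate h₃

      -- Otherwise {p₀ c₀, p₁ d₁, y q} is a 3K₂.
      meets : (S₀ : Spoke v₀ v₁ v₂ v₃ v₄) (S₁ : Spoke v₁ v₂ v₃ v₄ v₀) → let open Spoke in
        ∀ {q} → y ∼ q → q ≁ p S₀ → q ≁ p S₁ → q ≁ c S₀ → q ≁ d S₁ → ⊥
      meets S₀ S₁ {q} yq qp₀ qp₁ qc₀ qd₁ =
        -- The last two vertices exclude cross edges: `p₀ d₁` would close a triangle with `d₀`, and
        -- `p₁ c₀` one with `c₁`. The additional vertices in `forward` and `backward` have the same
        -- purpose.
        absurd forbidden x (y ∷ p S₀ ∷ p S₁ ∷ c S₀ ∷ d S₁ ∷ q ∷ d S₀ ∷ c S₁ ∷ [])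
          ((2 , 3) ∷ (2 , 5) ∷ (3 , 4) ∷ (1 , 2) ∷ (1 , 3) ∷ [])
          (0 — 1 ∶ xy ⨾ 0 — 2 ∶ xp S₀ ⨾ 0 — 3 ∶ xp S₁ ⨾ 2 — 4 ∶ pc S₀ ⨾ 3 — 5 ∶ pd S₁ ⨾
           2 — 7 ∶ pd S₀ ⨾ 3 — 8 ∶ pc S₁ ⨾ 1 — 6 ∶ yq ⨾
           4 — 5 ∶ apart (left (c∈ S₀)) (right (d∈ S₁)) ⨾
           7 — 5 ∶ complete h₁ (d∈ S₀) (d∈ S₁) ⨾ 4 — 8 ∶ complete h₄ (c∈ S₀) (c∈ S₁) ⨾
           1 — 4 ∶ ≁y (distant (c∈ S₀)) ⨾ 1 — 5 ∶ ≁y (distant (d∈ S₁)) ⨾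
           6 — 2 ∶ qp₀ ⨾ 6 — 3 ∶ qp₁ ⨾ 6 — 4 ∶ qc₀ ⨾ 6 — 5 ∶ qd₁ ⨾ [])
        where open Spoke

      -- Otherwise {w p₀, p₁ c₁, p₂ d₂} is a 3K₂.
      forward : (S₀ : Spoke v₀ v₁ v₂ v₃ v₄) (S₁ : Spoke v₁ v₂ v₃ v₄ v₀) (S₂ : Spoke v₂ v₃ v₄ v₀ v₁) →
        let open Spoke in (W : Anchor) → let open Anchor W in w ∼ p S₀ → w ≁ p S₁ → w ≁ p S₂ → ⊥
      forward S₀ S₁ S₂ W wp₀ wp₁ wp₂ =
        absurd forbidden x (w ∷ p S₀ ∷ p S₁ ∷ c S₁ ∷ p S₂ ∷ d S₂ ∷ c S₀ ∷ d S₁ ∷ c S₂ ∷ [])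
          ((2 , 3) ∷ (2 , 5) ∷ (3 , 5) ∷ (2 , 4) ∷ (2 , 6) ∷ (3 , 6) ∷ (5 , 4) ∷ [])
          (0 — 2 ∶ xp S₀ ⨾ 0 — 3 ∶ xp S₁ ⨾ 0 — 5 ∶ xp S₂ ⨾
           1 — 2 ∶ wp₀ ⨾ 1 — 3 ∶ wp₁ ⨾ 1 — 5 ∶ wp₂ ⨾ 3 — 4 ∶ pc S₁ ⨾ 5 — 6 ∶ pd S₂ ⨾
           2 — 7 ∶ pc S₀ ⨾ 3 — 8 ∶ pd S₁ ⨾ 5 — 9 ∶ pc S₂ ⨾
           1 — 4 ∶ w-apart (distant (c∈ S₁)) ⨾ 1 — 6 ∶ w-apart (distant (d∈ S₂)) ⨾
           4 — 6 ∶ apart (left (c∈ S₁)) (right (d∈ S₂)) ⨾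
           7 — 4 ∶ complete h₄ (c∈ S₀) (c∈ S₁) ⨾ 7 — 6 ∶ flip (complete h₃ (d∈ S₂) (c∈ S₀)) ⨾
           8 — 6 ∶ complete h₂ (d∈ S₁) (d∈ S₂) ⨾ 9 — 4 ∶ flip (complete h (c∈ S₁) (c∈ S₂)) ⨾ [])
        where
        open Spoke
        open Anchor W

      -- Otherwise {w p₀, p₃ c₃, p₄ d₄} is a 3K₂.
      backward : (S₀ : Spoke v₀ v₁ v₂ v₃ v₄) (S₃ : Spoke v₃ v₄ v₀ v₁ v₂) (S₄ : Spoke v₄ v₀ v₁ v₂ v₃) →
        let open Spoke in (W : Anchor) → let open Anchor W in w ∼ p S₀ → w ≁ p S₃ → w ≁ p S₄ → ⊥
      backward S₀ S₃ S₄ W wp₀ wp₃ wp₄ =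
        absurd forbidden x (w ∷ p S₀ ∷ p S₃ ∷ c S₃ ∷ p S₄ ∷ d S₄ ∷ c S₀ ∷ d S₀ ∷ d S₃ ∷ c S₄ ∷ [])
          ((2 , 3) ∷ (2 , 5) ∷ (3 , 5) ∷ (2 , 4) ∷ (2 , 6) ∷ (3 , 6) ∷ (5 , 4) ∷ [])
          (0 — 2 ∶ xp S₀ ⨾ 0 — 3 ∶ xp S₃ ⨾ 0 — 5 ∶ xp S₄ ⨾
           1 — 2 ∶ wp₀ ⨾ 1 — 3 ∶ wp₃ ⨾ 1 — 5 ∶ wp₄ ⨾ 3 — 4 ∶ pc S₃ ⨾ 5 — 6 ∶ pd S₄ ⨾
           2 — 7 ∶ pc S₀ ⨾ 2 — 8 ∶ pd S₀ ⨾ 3 — 9 ∶ pd S₃ ⨾ 5 — 10 ∶ pc S₄ ⨾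
           1 — 4 ∶ w-apart (distant (c∈ S₃)) ⨾ 1 — 6 ∶ w-apart (distant (d∈ S₄)) ⨾
           4 — 6 ∶ apart (left (c∈ S₃)) (right (d∈ S₄)) ⨾
           7 — 6 ∶ complete h₄ (c∈ S₀) (d∈ S₄) ⨾ 8 — 4 ∶ complete h₁ (d∈ S₀) (c∈ S₃) ⨾
           9 — 6 ∶ complete h₄ (d∈ S₃) (d∈ S₄) ⨾ 10 — 4 ∶ flip (complete h₂ (c∈ S₃) (c∈ S₄)) ⨾ [])
        where
        open Spoke
        open Anchor W

    -- Up to rotation this is the only possible nonempty set of pᵣ adjacent to w (see `kinds`).
    Kind : (p₀ p₁ p₂ p₃ p₄ w : V) → Set
    Kind p₀ p₁ p₂ p₃ p₄ w = w ∼ p₀ × w ≁ p₁ × w ∼ p₂ × w ∼ p₃ × w ≁ p₄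

    module Five {v₀ v₁ v₂ v₃ v₄ : V} (h : Hole v₀ v₁ v₂ v₃ v₄)
      (S₀ : Spoke v₀ v₁ v₂ v₃ v₄) (S₁ : Spoke v₁ v₂ v₃ v₄ v₀) (S₂ : Spoke v₂ v₃ v₄ v₀ v₁)
      (S₃ : Spoke v₃ v₄ v₀ v₁ v₂) (S₄ : Spoke v₄ v₀ v₁ v₂ v₃) where
      open Spoke S₀ public
        renaming (p to p₀; c to c₀; d to d₀; xp to xp₀; c∈ to c₀∈; d∈ to d₀∈;
                  pc to pc₀; pd to pd₀; anchor to W₀; wp to wp₀)
      open Spoke S₁ public
        renaming (p to p₁; c to c₁; d to d₁; xp to xp₁; c∈ to c₁∈; d∈ to d₁∈;
                  pc to pc₁; pd to pd₁; anchor to W₁; wp to wp₁)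
      open Spoke S₂ public
        renaming (p to p₂; c to c₂; d to d₂; xp to xp₂; c∈ to c₂∈; d∈ to d₂∈;
                  pc to pc₂; pd to pd₂; anchor to W₂; wp to wp₂)
      open Spoke S₃ public
        renaming (p to p₃; c to c₃; d to d₃; xp to xp₃; c∈ to c₃∈; d∈ to d₃∈;
                  pc to pc₃; pd to pd₃; anchor to W₃; wp to wp₃)
      open Spoke S₄ public
        renaming (p to p₄; c to c₄; d to d₄; xp to xp₄; c∈ to c₄∈; d∈ to d₄∈;
                  pc to pc₄; pd to pd₄; anchor to W₄; wp to wp₄)
      private
        h₁ = rotate h
        h₂ = rotate h₁
        h₃ = rotate h₂
        h₄ = rotate h₃

      not₀₁ : ∀ {q a b} → q ∼ a → q ∼ b → Class v₄ v₁ a → Class v₀ v₂ b → ⊥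
      not₀₁ qa qb a∈ b∈ = triangle qa qb (complete h a∈ b∈)
      not₁₂ : ∀ {q a b} → q ∼ a → q ∼ b → Class v₀ v₂ a → Class v₁ v₃ b → ⊥
      not₁₂ qa qb a∈ b∈ = triangle qa qb (complete h₁ a∈ b∈)
      not₂₃ : ∀ {q a b} → q ∼ a → q ∼ b → Class v₁ v₃ a → Class v₂ v₄ b → ⊥
      not₂₃ qa qb a∈ b∈ = triangle qa qb (complete h₂ a∈ b∈)
      not₃₄ : ∀ {q a b} → q ∼ a → q ∼ b → Class v₂ v₄ a → Class v₃ v₀ b → ⊥
      not₃₄ qa qb a∈ b∈ = triangle qa qb (complete h₃ a∈ b∈)
      not₄₀ : ∀ {q a b} → q ∼ a → q ∼ b → Class v₃ v₀ a → Class v₄ v₁ b → ⊥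
      not₄₀ qa qb a∈ b∈ = triangle qa qb (complete h₄ a∈ b∈)

      either : ∀ {q a b} → (q ≁ a → q ≁ b → ⊥) → q ∼ a ⊎ q ∼ b
      either {q} {a} {b} f with cases q a | cases q b
      ... | inj₁ qa | _       = inj₁ qa
      ... | inj₂ _  | inj₁ qb = inj₂ qb
      ... | inj₂ qa | inj₂ qb = ⊥-elim (f qa qb)

      module _ {q : V} (yq : y ∼ q) where
        meets₀₁ : q ≁ p₀ → q ≁ p₁ → q ∼ c₀ ⊎ q ∼ d₁
        meets₀₁ n n′ = either (meets h S₀ S₁ yq n n′)
        meets₁₂ : q ≁ p₁ → q ≁ p₂ → q ∼ c₁ ⊎ q ∼ d₂
        meets₁₂ n n′ = either (meets h₁ S₁ S₂ yq n n′)
        meets₂₃ : q ≁ p₂ → q ≁ p₃ → q ∼ c₂ ⊎ q ∼ d₃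
        meets₂₃ n n′ = either (meets h₂ S₂ S₃ yq n n′)
        meets₃₄ : q ≁ p₃ → q ≁ p₄ → q ∼ c₃ ⊎ q ∼ d₄
        meets₃₄ n n′ = either (meets h₃ S₃ S₄ yq n n′)
        meets₄₀ : q ≁ p₄ → q ≁ p₀ → q ∼ c₄ ⊎ q ∼ d₀
        meets₄₀ n n′ = either (meets h₄ S₄ S₀ yq n n′)

        -- Here cᵣ lies in Aᵣ₋₁ and dᵣ in Aᵣ₊₁. So `q` has neighbours in A₄ or A₂, in A₀ or A₃, and
        -- in A₁ or A₄; every choice contains two consecutive classes and hence gives a triangle.
        avoids-0123 : q ≁ p₀ → q ≁ p₁ → q ≁ p₂ → q ≁ p₃ → ⊥
        avoids-0123 n₀ n₁ n₂ n₃ with meets₂₃ n₂ n₃ | meets₁₂ n₁ n₂ | meets₀₁ n₀ n₁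
        ... | inj₁ qc₂ | inj₁ qc₁ | _        = not₀₁ qc₁ qc₂ c₁∈ c₂∈
        ... | inj₁ qc₂ | inj₂ qd₂ | inj₁ qc₀ = not₃₄ qd₂ qc₀ d₂∈ c₀∈
        ... | inj₁ qc₂ | inj₂ qd₂ | inj₂ qd₁ = not₁₂ qc₂ qd₁ c₂∈ d₁∈
        ... | inj₂ qd₃ | inj₁ qc₁ | _        = not₄₀ qd₃ qc₁ d₃∈ c₁∈
        ... | inj₂ qd₃ | inj₂ qd₂ | _        = not₃₄ qd₂ qd₃ d₂∈ d₃∈

        -- The same argument with A₁ or A₄, A₂ or A₀, and A₃ or A₁.
        avoids-0234 : q ≁ p₀ → q ≁ p₂ → q ≁ p₃ → q ≁ p₄ → ⊥
        avoids-0234 n₀ n₂ n₃ n₄ with meets₂₃ n₂ n₃ | meets₃₄ n₃ n₄ | meets₄₀ n₄ n₀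
        ... | inj₁ qc₂ | inj₁ qc₃ | _        = not₁₂ qc₂ qc₃ c₂∈ c₃∈
        ... | inj₁ qc₂ | inj₂ qd₄ | _        = not₀₁ qd₄ qc₂ d₄∈ c₂∈
        ... | inj₂ qd₃ | inj₂ qd₄ | _        = not₄₀ qd₃ qd₄ d₃∈ d₄∈
        ... | inj₂ qd₃ | inj₁ qc₃ | inj₁ qc₄ = not₃₄ qc₄ qd₃ c₄∈ d₃∈
        ... | inj₂ qd₃ | inj₁ qc₃ | inj₂ qd₀ = not₁₂ qd₀ qc₃ d₀∈ c₃∈

      module _ (W : Anchor) where
        open Anchor W

        -- By triangle-freeness `q` misses every pᵣ adjacent to `w`, so a fourth such pᵣ would leave
        -- `q` avoiding too many of them.
        kind : w ∼ p₀ → w ∼ p₂ → w ∼ p₃ → Kind p₀ p₁ p₂ p₃ p₄ w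
        kind wp₀ wp₂ wp₃ with cases w p₁ | cases w p₄
        ... | inj₁ wp₁ | _        = ⊥-elim
          (avoids-0123 yq (apart wq wp₀) (apart wq wp₁) (apart wq wp₂) (apart wq wp₃))
        ... | inj₂ _   | inj₁ wp₄ = ⊥-elim
          (avoids-0234 yq (apart wq wp₀) (apart wq wp₂) (apart wq wp₃) (apart wq wp₄))
        ... | inj₂ wp₁ | inj₂ wp₄ = wp₀ , wp₁ , wp₂ , wp₃ , wp₄

      -- The edges `x p₃`, `q d₂` and `q′ c₄` form a 3K₂. The cross edges `q c₄` and `q′ d₂` are
      -- excluded by `q ∼ p₄` and `q′ ∼ p₂`.
      clash : (W W′ : Anchor) → Kind p₀ p₁ p₂ p₃ p₄ (Anchor.w W) → Kind p₁ p₂ p₃ p₄ p₀ (Anchor.w W′) → ⊥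
      clash W W′ (wp₀ , wp₁ , wp₂ , wp₃ , wp₄) (w′p₁ , w′p₂ , w′p₃ , w′p₄ , w′p₀) =
        absurd forbidden x (y ∷ q ∷ d₂ ∷ q′ ∷ c₄ ∷ p₃ ∷ [])
          ((0 , 2) ∷ (0 , 4) ∷ (2 , 4) ∷ [])
          (0 — 1 ∶ xy ⨾ 1 — 2 ∶ yq ⨾ 1 — 4 ∶ yq′ ⨾ 2 — 3 ∶ qd₂ ⨾ 4 — 5 ∶ q′c₄ ⨾ 0 — 6 ∶ xp₃ ⨾
           0 — 3 ∶ ≁x (distant d₂∈) ⨾ 0 — 5 ∶ ≁x (distant c₄∈) ⨾
           3 — 5 ∶ apart (left d₂∈) (left c₄∈) ⨾
           2 — 5 ∶ apart (flip qp₄) pc₄ ⨾ 4 — 3 ∶ apart (flip q′p₂) pd₂ ⨾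
           6 — 2 ∶ flip qp₃ ⨾ 6 — 4 ∶ flip q′p₃ ⨾ 6 — 3 ∶ p₃d₂ ⨾ 6 — 5 ∶ p₃c₄ ⨾ [])
        where
        open Anchor W
        open Anchor W′ using ()
          renaming (w to w′; q to q′; w-far to w′-far; w-apart to w′-apart; yq to yq′; wq to w′q′)
        qp₀ : q ≁ p₀
        qp₀ = apart wq wp₀
        qp₂ : q ≁ p₂
        qp₂ = apart wq wp₂
        qp₃ : q ≁ p₃
        qp₃ = apart wq wp₃
        q′p₁ : q′ ≁ p₁
        q′p₁ = apart w′q′ w′p₁
        q′p₃ : q′ ≁ p₃
        q′p₃ = apart w′q′ w′p₃
        q′p₄ : q′ ≁ p₄
        q′p₄ = apart w′q′ w′p₄
        p₃d₂ : p₃ ≁ d₂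
        p₃d₂ = apart (flip pc₃) (complete h₂ c₃∈ d₂∈)
        p₃c₄ : p₃ ≁ c₄
        p₃c₄ = apart (flip pc₃) (complete h₂ c₃∈ c₄∈)
        p₂p₃ : p₂ ≁ p₃
        p₂p₃ = apart xp₂ xp₃
        p₄p₃ : p₄ ≁ p₃
        p₄p₃ = apart xp₄ xp₃
        -- An edge `q w′` would make `q` miss `p₁` as well, hence all of `p₀`, ..., `p₃`; similarly
        -- for `q′` and `w`.
        qw′ : q ≁ w′
        qw′ with cases q w′
        ... | inj₂ n   = n
        ... | inj₁ qw′ = ⊥-elim (avoids-0123 yq qp₀ (apart (flip qw′) w′p₁) qp₂ qp₃)
        q′w : q′ ≁ w
        q′w with cases q′ w
        ... | inj₂ n   = n
        ... | inj₁ q′w = ⊥-elim (avoids-0123 yq′ (apart (flip q′w) wp₀) q′p₁ (apart (flip q′w) wp₂) q′p₃)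
        -- Otherwise {p₃ w′, p₂ d₂, y q} is a 3K₂.
        qd₂ : q ∼ d₂
        qd₂ = derive forbidden x (y ∷ q ∷ p₃ ∷ w′ ∷ p₂ ∷ d₂ ∷ []) 2 6 true ((1 , 3) ∷ (1 , 5) ∷ [])
          (0 — 1 ∶ xy ⨾ 0 — 3 ∶ xp₃ ⨾ 0 — 5 ∶ xp₂ ⨾ 1 — 2 ∶ yq ⨾ 3 — 4 ∶ flip w′p₃ ⨾ 5 — 6 ∶ pd₂ ⨾
           1 — 4 ∶ ≁y w′-far ⨾ 1 — 6 ∶ ≁y (distant d₂∈) ⨾ 3 — 5 ∶ flip p₂p₃ ⨾ 3 — 6 ∶ p₃d₂ ⨾
           4 — 5 ∶ w′p₂ ⨾ 4 — 6 ∶ w′-apart (distant d₂∈) ⨾ 2 — 3 ∶ qp₃ ⨾ 2 — 4 ∶ qw′ ⨾ 2 — 5 ∶ qp₂ ⨾ [])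
        -- Since `q` already has the neighbour `d₂` in A₃, all choices offered by `meets₂₃` and
        -- `meets₃₄` lead to consecutive classes.
        qp₄ : q ∼ p₄
        qp₄ = decided λ n → case (meets₂₃ yq qp₂ qp₃) (meets₃₄ yq qp₃ n)
          where
          case : q ∼ c₂ ⊎ q ∼ d₃ → q ∼ c₃ ⊎ q ∼ d₄ → ⊥
          case _          (inj₁ qc₃) = not₂₃ qc₃ qd₂ c₃∈ d₂∈
          case (inj₁ qc₂) (inj₂ qd₄) = not₀₁ qd₄ qc₂ d₄∈ c₂∈
          case (inj₂ qd₃) (inj₂ qd₄) = not₃₄ qd₂ qd₃ d₂∈ d₃∈
        -- Otherwise {p₃ w, p₄ c₄, y q′} is a 3K₂.
        q′c₄ : q′ ∼ c₄
        q′c₄ = derive forbidden x (y ∷ q′ ∷ p₃ ∷ w ∷ p₄ ∷ c₄ ∷ []) 2 6 true ((1 , 3) ∷ (1 , 5) ∷ [])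
          (0 — 1 ∶ xy ⨾ 0 — 3 ∶ xp₃ ⨾ 0 — 5 ∶ xp₄ ⨾ 1 — 2 ∶ yq′ ⨾ 3 — 4 ∶ flip wp₃ ⨾ 5 — 6 ∶ pc₄ ⨾
           1 — 4 ∶ ≁y w-far ⨾ 1 — 6 ∶ ≁y (distant c₄∈) ⨾ 3 — 5 ∶ flip p₄p₃ ⨾ 3 — 6 ∶ p₃c₄ ⨾
           4 — 5 ∶ wp₄ ⨾ 4 — 6 ∶ w-apart (distant c₄∈) ⨾ 2 — 3 ∶ q′p₃ ⨾ 2 — 4 ∶ q′w ⨾ 2 — 5 ∶ q′p₄ ⨾ [])
        q′p₂ : q′ ∼ p₂
        q′p₂ = decided λ n → case (meets₂₃ yq′ n q′p₃) (meets₃₄ yq′ q′p₃ q′p₄)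
          where
          case : q′ ∼ c₂ ⊎ q′ ∼ d₃ → q′ ∼ c₃ ⊎ q′ ∼ d₄ → ⊥
          case _          (inj₁ qc₃) = not₂₃ qc₃ q′c₄ c₃∈ c₄∈
          case (inj₁ qc₂) (inj₂ qd₄) = not₀₁ qd₄ qc₂ d₄∈ c₂∈
          case (inj₂ qd₃) (inj₂ qd₄) = not₃₄ q′c₄ qd₃ c₄∈ d₃∈

    module Spoked {v₀ v₁ v₂ v₃ v₄ : V} (h : Hole v₀ v₁ v₂ v₃ v₄)
      (S₀ : Spoke v₀ v₁ v₂ v₃ v₄) (S₁ : Spoke v₁ v₂ v₃ v₄ v₀) (S₂ : Spoke v₂ v₃ v₄ v₀ v₁)
      (S₃ : Spoke v₃ v₄ v₀ v₁ v₂) (S₄ : Spoke v₄ v₀ v₁ v₂ v₃) where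
      h₁ = rotate h
      h₂ = rotate h₁
      h₃ = rotate h₂
      h₄ = rotate h₃
      module F₀ = Five h  S₀ S₁ S₂ S₃ S₄
      module F₂ = Five h₂ S₂ S₃ S₄ S₀ S₁
      module F₃ = Five h₃ S₃ S₄ S₀ S₁ S₂
      module F₄ = Five h₄ S₄ S₀ S₁ S₂ S₃
      open F₀ using (p₀; p₁; p₂; p₃; p₄)

      -- By `forward` and `backward`, `w` has a neighbour among `p₁`, `p₂` and one among `p₃`, `p₄`.
      -- Three of the four choices give the three kinds; the neighbourhood `{p₄, p₀, p₁}`
      -- contradicts `forward` started at `p₁`.
      kinds : (W : Anchor) → let open Anchor W in w ∼ p₀ →
        Kind p₀ p₁ p₂ p₃ p₄ w ⊎ Kind p₃ p₄ p₀ p₁ p₂ w ⊎ Kind p₂ p₃ p₄ p₀ p₁ w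
      kinds W wp₀ with cases w p₁ | cases w p₂ | cases w p₃ | cases w p₄
        where open Anchor W
      ... | inj₂ n₁ | inj₂ n₂ | _ | _ = ⊥-elim (forward h S₀ S₁ S₂ W wp₀ n₁ n₂)
      ... | _ | _ | inj₂ n₃ | inj₂ n₄ = ⊥-elim (backward h S₀ S₃ S₄ W wp₀ n₃ n₄)
      ... | _ | inj₁ a₂ | inj₁ a₃ | _ = inj₁ (F₀.kind W wp₀ a₂ a₃)
      ... | inj₁ a₁ | _ | inj₁ a₃ | _ = inj₂ (inj₁ (F₃.kind W a₃ wp₀ a₁))
      ... | _ | inj₁ a₂ | _ | inj₁ a₄ = inj₂ (inj₂ (F₂.kind W a₂ a₄ wp₀))
      ... | inj₁ a₁ | inj₂ n₂ | inj₂ n₃ | inj₁ a₄ = ⊥-elim (forward h₁ S₁ S₂ S₃ W a₁ n₂ n₃)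

    module _ {v₀ v₁ v₂ v₃ v₄ : V} (h : Hole v₀ v₁ v₂ v₃ v₄)
      (S₀ : Spoke v₀ v₁ v₂ v₃ v₄) (S₁ : Spoke v₁ v₂ v₃ v₄ v₀) (S₂ : Spoke v₂ v₃ v₄ v₀ v₁)
      (S₃ : Spoke v₃ v₄ v₀ v₁ v₂) (S₄ : Spoke v₄ v₀ v₁ v₂ v₃) where
      open Spoked h S₀ S₁ S₂ S₃ S₄ using (h₁; h₂; h₃; h₄; module F₀; module F₂; module F₄)
      open F₀ using (p₀; p₁; p₂; p₃; p₄; W₁; wp₁; W₄; wp₄)

      -- Two vertices of consecutive kinds clash, and the anchors of S₁ and S₄ always produce them.
      no-kind : (W : Anchor) → Kind p₀ p₁ p₂ p₃ p₄ (Anchor.w W) → ⊥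
      no-kind W k with Spoked.kinds h₁ S₁ S₂ S₃ S₄ S₀ W₁ wp₁
      ... | inj₁ k₁        = F₀.clash W W₁ k k₁
      ... | inj₂ (inj₁ k₄) = F₄.clash W₁ W k₄ k
      ... | inj₂ (inj₂ k₃) with Spoked.kinds h₄ S₄ S₀ S₁ S₂ S₃ W₄ wp₄
      ...   | inj₁ k₄        = F₄.clash W₄ W k₄ k
      ...   | inj₂ (inj₁ k₂) = F₂.clash W₄ W₁ k₂ k₃
      ...   | inj₂ (inj₂ k₁) = F₀.clash W W₄ k k₁

    not-five-spokes : ∀ {v₀ v₁ v₂ v₃ v₄} → Hole v₀ v₁ v₂ v₃ v₄ →
      Spoke v₀ v₁ v₂ v₃ v₄ → Spoke v₁ v₂ v₃ v₄ v₀ → Spoke v₂ v₃ v₄ v₀ v₁ →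
      Spoke v₃ v₄ v₀ v₁ v₂ → Spoke v₄ v₀ v₁ v₂ v₃ → ⊥
    not-five-spokes h S₀ S₁ S₂ S₃ S₄ with Spoked.kinds h S₀ S₁ S₂ S₃ S₄ (Spoke.anchor S₀) (Spoke.wp S₀)
    ... | inj₁ k        = no-kind h S₀ S₁ S₂ S₃ S₄ (Spoke.anchor S₀) k
    ... | inj₂ (inj₁ k) = no-kind (rotate (rotate (rotate h))) S₃ S₄ S₀ S₁ S₂ (Spoke.anchor S₀) k
    ... | inj₂ (inj₂ k) = no-kind (rotate (rotate h)) S₂ S₃ S₄ S₀ S₁ (Spoke.anchor S₀) k

    -- The 4-colourings

    4Colourable : Set
    4Colourable = Σ (V → Fin 4) λ c → ∀ u v → u ∼ v → c u ≢ c v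

    -- A relation `Col` keeps the reason for each colour, so that properness becomes a case
    -- distinction on two reasons.
    module _ (Col : V → Fin 4 → Set) (colour : ∀ u → ∃ (Col u))
      (clash : ∀ {u v k} → Col u k → Col v k → u ∼ v → ⊥) where

      from-view : 4Colourable
      from-view = (λ u → proj₁ (colour u)) , λ u v uv eq →
        clash (proj₂ (colour u)) (subst (Col v) (≡-sym eq) (proj₂ (colour v))) uv

    module _ (search : {P : V → Set} → (∀ v → Dec (P v)) → Dec (∃ P)) where

      ∼? : ∀ u v → Dec (u ∼ v)
      ∼? u v = e u v Bool.≟ true

      far? : ∀ u → Dec (Far u)
      far? u = map′ (λ (a , b) → far a b) (λ (far a b) → a , b)
        ((e x u Bool.≟ false) ×-dec (e y u Bool.≟ false))

      Hits : V → V → V → Set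
      Hits v v′ p = ∃ λ a → Class v v′ a × p ∼ a

      hits? : ∀ v v′ p → Dec (Hits v v′ p)
      hits? v v′ p = search λ a →
        map′ (λ (f , l , r) → class f l r) (λ (class f l r) → f , l , r)
          (far? a ×-dec ∼? v a ×-dec ∼? v′ a) ×-dec ∼? p a

      module _ {v₀ v₁ v₂ v₃ v₄ : V} (h : Hole v₀ v₁ v₂ v₃ v₄) where
        isolated? : ∀ w → Dec (Isolated v₀ v₁ v₂ v₃ v₄ w)
        isolated? w = map′ (λ (f , a , b , c , d , g) → isolated f a b c d g)
          (λ (isolated f a b c d g) → f , a , b , c , d , g)
          (far? w ×-dec (e w v₀ Bool.≟ false) ×-dec (e w v₁ Bool.≟ false) ×-dec (e w v₂ Bool.≟ false)
            ×-dec (e w v₃ Bool.≟ false) ×-dec (e w v₄ Bool.≟ false))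

        HasSpoke : Set
        HasSpoke = ∃ λ p → x ∼ p × Hits v₃ v₀ p × Hits v₀ v₂ p ×
                   ∃ λ w → Isolated v₀ v₁ v₂ v₃ v₄ w × w ∼ p × ∃ λ q → y ∼ q × w ∼ q

        spoke? : Dec HasSpoke
        spoke? = search λ p → ∼? x p ×-dec hits? v₃ v₀ p ×-dec hits? v₀ v₂ p ×-dec
                 search λ w → isolated? w ×-dec ∼? w p ×-dec search λ q → ∼? y q ×-dec ∼? w q

        spoke : HasSpoke → Spoke v₀ v₁ v₂ v₃ v₄
        spoke (p , xp , (c , c∈ , pc) , (d , d∈ , pd) , w , iso , wp , q , yq , wq) = record
          { xp = xp ; c∈ = c∈ ; d∈ = d∈ ; pc = pc ; pd = pd
          ; anchor = record { w-far = Isolated.distant iso ; w-apart = isolated-apart h iso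
                            ; yq = yq ; wq = wq }
          ; wp = wp }

        -- Otherwise `{x y, u v₂, v₀ v₄}` is a 3K₂. Up to rotation this says that a far vertex with
        -- a neighbour on the hole has two of them at distance two.
        second : ∀ {u} → Far u → v₂ ∼ u → v₀ ≁ u → v₄ ∼ u
        second {u} (far xu yu) 2u 0u =
          derive forbidden x (y ∷ v₀ ∷ v₁ ∷ v₂ ∷ v₃ ∷ v₄ ∷ u ∷ []) 6 7 true []
            (base h (0 — 7 ∶ xu ⨾ 1 — 7 ∶ yu ⨾ 4 — 7 ∶ 2u ⨾ 2 — 7 ∶ 0u ⨾ []))

      module _ {v₀ v₁ v₂ v₃ v₄ : V} (h : Hole v₀ v₁ v₂ v₃ v₄) (unspoked : ¬ HasSpoke h) where
        private
          h₁ = rotate h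
          h₂ = rotate h₁
          h₃ = rotate h₂
          h₄ = rotate h₃

        -- I is divided: vertices with a neighbour in N(`y`) share a colour with A₀ and P₀, the
        -- others join N(`y`). The far neighbours of `v₂` make up A₁ ∪ A₃, those of `v₃` make up A₂
        -- ∪ A₄. Vertices of `P₂` have no neighbour in A₁ ∪ A₃; those of `P₃` and `P₃′` have none in
        -- A₂ ∪ A₄, because a neighbour in A₁ excludes A₂ and one in A₃ excludes both.
        data Col (u : V) : Fin 4 → Set where
          A₀  : Class v₄ v₁ u → Col u 0F
          P₀  : x ∼ u → Hits v₃ v₀ u → Hits v₀ v₂ u → Col u 0F
          I₀  : ∀ {q} → Isolated v₀ v₁ v₂ v₃ v₄ u → y ∼ q → u ∼ q → Col u 0F
          Q₁  : y ∼ u → Col u 1F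
          I₁  : Isolated v₀ v₁ v₂ v₃ v₄ u → ¬ (∃ λ q → y ∼ q × u ∼ q) → Col u 1F
          A₁₃ : Far u → v₂ ∼ u → Col u 2F
          P₂  : x ∼ u → ¬ Hits v₀ v₂ u → ¬ Hits v₂ v₄ u → Col u 2F
          A₂₄ : Far u → v₃ ∼ u → Col u 3F
          P₃  : x ∼ u → ¬ Hits v₃ v₀ u → Hits v₀ v₂ u → Col u 3F
          P₃′ : x ∼ u → Hits v₂ v₄ u → Col u 3F

        hits-consecutive : ∀ {v v′ v″ v‴ p} → (∀ {a b} → Class v v′ a → Class v″ v‴ b → a ∼ b) →
          Hits v v′ p → Hits v″ v‴ p → ⊥
        hits-consecutive compl (a , a∈ , pa) (b , b∈ , pb) = triangle pa pb (compl a∈ b∈)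

        private
          clash₀ : ∀ {u v} → Class v₄ v₁ u → Hits v₀ v₂ v → u ∼ v → ⊥
          clash₀ u∈ hit uv = hits-consecutive (complete h) (_ , u∈ , flip uv) hit
          clash₂ : ∀ {u v} → Far u → v₂ ∼ u → ¬ Hits v₀ v₂ v → ¬ Hits v₂ v₄ v → u ∼ v → ⊥
          clash₂ {u} fu 2u ¬1 ¬3 uv with cases v₀ u
          ... | inj₁ 0u = ¬1 (u , class fu 0u 2u , flip uv)
          ... | inj₂ 0u = ¬3 (u , class fu 2u (second h fu 2u 0u) , flip uv)
          class₂₄ : ∀ {u} → Far u → v₃ ∼ u → Class v₁ v₃ u ⊎ Class v₃ v₀ u
          class₂₄ {u} fu 3u with cases v₁ u
          ... | inj₁ 1u = inj₁ (class fu 1u 3u)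
          ... | inj₂ 1u = inj₂ (class fu 3u (second h₁ fu 3u 1u))
          clash₃ : ∀ {u v} → Far u → v₃ ∼ u → ¬ Hits v₃ v₀ v → Hits v₀ v₂ v → u ∼ v → ⊥
          clash₃ {u} fu 3u ¬4 hit₁ uv with class₂₄ fu 3u
          ... | inj₂ u∈ = ¬4 (u , u∈ , flip uv)
          ... | inj₁ u∈ = hits-consecutive (complete h₁) hit₁ (u , u∈ , flip uv)
          clash₃′ : ∀ {u v} → Far u → v₃ ∼ u → Hits v₂ v₄ v → u ∼ v → ⊥
          clash₃′ {u} fu 3u hit₃ uv with class₂₄ fu 3u
          ... | inj₂ u∈ = hits-consecutive (complete h₃) hit₃ (u , u∈ , flip uv)
          ... | inj₁ u∈ = hits-consecutive (complete h₂) (u , u∈ , flip uv) hit₃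
          iso : ∀ {u v} → Isolated v₀ v₁ v₂ v₃ v₄ u → Far v → u ∼ v → ⊥
          iso i f uv with () ← trans (≡-sym uv) (isolated-apart h i f)

        clash : ∀ {u v k} → Col u k → Col v k → u ∼ v → ⊥
        clash (A₀ a)      (A₀ b)       uv = triangle (left a) (left b) uv
        clash (A₀ a)      (P₀ _ _ hit) uv = clash₀ a hit uv
        clash (P₀ _ _ hit) (A₀ b)      uv = clash₀ b hit (flip uv)
        clash (A₀ a)      (I₀ i _ _)   uv = iso i (distant a) (flip uv)
        clash (I₀ i _ _)  (A₀ b)       uv = iso i (distant b) uv
        clash (P₀ xu _ _) (P₀ xv _ _)  uv = triangle xu xv uv
        clash (P₀ xu h₄ h₁) (I₀ i yq vq) uv = unspoked (_ , xu , h₄ , h₁ , _ , i , flip uv , _ , yq , vq)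
        clash (I₀ i yq uq) (P₀ xv h₄ h₁) uv = unspoked (_ , xv , h₄ , h₁ , _ , i , uv , _ , yq , uq)
        clash (I₀ i _ _)  (I₀ j _ _)   uv = iso i (Isolated.distant j) uv
        clash (Q₁ yu)     (Q₁ yv)      uv = triangle yu yv uv
        clash (Q₁ yu)     (I₁ _ none)  uv = none (_ , yu , flip uv)
        clash (I₁ _ none) (Q₁ yv)      uv = none (_ , yv , uv)
        clash (I₁ i _)    (I₁ j _)     uv = iso i (Isolated.distant j) uv
        clash (A₁₃ _ 2u)  (A₁₃ _ 2v)   uv = triangle 2u 2v uv
        clash (A₁₃ fu 2u) (P₂ _ ¬1 ¬3) uv = clash₂ fu 2u ¬1 ¬3 uv
        clash (P₂ _ ¬1 ¬3) (A₁₃ fv 2v) uv = clash₂ fv 2v ¬1 ¬3 (flip uv)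
        clash (P₂ xu _ _) (P₂ xv _ _)  uv = triangle xu xv uv
        clash (A₂₄ _ 3u)  (A₂₄ _ 3v)   uv = triangle 3u 3v uv
        clash (A₂₄ fu 3u) (P₃ _ ¬4 hit) uv = clash₃ fu 3u ¬4 hit uv
        clash (A₂₄ fu 3u) (P₃′ _ hit) uv = clash₃′ fu 3u hit uv
        clash (P₃ _ ¬4 hit) (A₂₄ fv 3v) uv = clash₃ fv 3v ¬4 hit (flip uv)
        clash (P₃′ _ hit) (A₂₄ fv 3v) uv = clash₃′ fv 3v hit (flip uv)
        clash (P₃ xu _ _)  (P₃ xv _ _)  uv = triangle xu xv uv
        clash (P₃ xu _ _)  (P₃′ xv _) uv = triangle xu xv uv
        clash (P₃′ xu _) (P₃ xv _ _)  uv = triangle xu xv uv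
        clash (P₃′ xu _) (P₃′ xv _) uv = triangle xu xv uv

        colour : ∀ u → ∃ (Col u)
        colour u with cases y u | cases x u
        ... | inj₁ yu | _       = _ , Q₁ yu
        ... | inj₂ _  | inj₁ xu with hits? v₃ v₀ u | hits? v₀ v₂ u | hits? v₂ v₄ u
        ...   | yes h₄ | yes h₁ | _      = _ , P₀ xu h₄ h₁
        ...   | no ¬h₄ | yes h₁ | _      = _ , P₃ xu ¬h₄ h₁
        ...   | _      | no ¬h₁ | yes h₃ = _ , P₃′ xu h₃
        ...   | _      | no ¬h₁ | no ¬h₃ = _ , P₂ xu ¬h₁ ¬h₃
        colour u | inj₂ yu | inj₂ xu with cases v₂ u | cases v₃ u | cases v₁ u
        ...   | inj₁ 2u | _       | _       = _ , A₁₃ (far xu yu) 2u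
        ...   | inj₂ _  | inj₁ 3u | _       = _ , A₂₄ (far xu yu) 3u
        ...   | inj₂ 2u | inj₂ 3u | inj₁ 1u = _ , A₀ (class (far xu yu) 4u 1u)
          where
          4u : v₄ ∼ u
          4u with cases v₄ u
          ... | inj₁ 4u = 4u
          ... | inj₂ 4u with () ← trans (≡-sym 3u) (second h₄ (far xu yu) 1u 4u)
        ...   | inj₂ 2u | inj₂ 3u | inj₂ 1u = isolated-colour (search λ q → ∼? y q ×-dec ∼? u q)
          where
          0u : v₀ ≁ u
          0u with cases v₀ u
          ... | inj₂ 0u = 0u
          ... | inj₁ 0u with () ← trans (≡-sym 2u) (second h₃ (far xu yu) 0u 3u)
          4u : v₄ ≁ u
          4u with cases v₄ u
          ... | inj₂ 4u = 4u
          ... | inj₁ 4u with () ← trans (≡-sym 1u) (second h₂ (far xu yu) 4u 2u)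
          i : Isolated v₀ v₁ v₂ v₃ v₄ u
          i = isolated (far xu yu) (flip 0u) (flip 1u) (flip 2u) (flip 3u) (flip 4u)
          isolated-colour : Dec (∃ λ q → y ∼ q × u ∼ q) → ∃ (Col u)
          isolated-colour (yes (_ , yq , uq)) = _ , I₀ i yq uq
          isolated-colour (no none)           = _ , I₁ i none

        unspoked-4-colourable : 4Colourable
        unspoked-4-colourable = from-view Col colour clash

      hole-4-colourable : ∀ {v₀ v₁ v₂ v₃ v₄} → Hole v₀ v₁ v₂ v₃ v₄ → 4Colourable
      hole-4-colourable h with spoke? h
      ... | no n = unspoked-4-colourable h n
      ... | yes s₀ with spoke? (rotate h)
      ...   | no n = unspoked-4-colourable (rotate h) n
      ...   | yes s₁ with spoke? (rotate (rotate h))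
      ...     | no n = unspoked-4-colourable (rotate (rotate h)) n
      ...     | yes s₂ with spoke? (rotate (rotate (rotate h)))
      ...       | no n = unspoked-4-colourable (rotate (rotate (rotate h))) n
      ...       | yes s₃ with spoke? (rotate (rotate (rotate (rotate h))))
      ...         | no n = unspoked-4-colourable (rotate (rotate (rotate (rotate h)))) n
      ...         | yes s₄ = ⊥-elim (not-five-spokes h (spoke h s₀) (spoke (rotate h) s₁)
                    (spoke (rotate (rotate h)) s₂) (spoke (rotate (rotate (rotate h))) s₃)
                    (spoke (rotate (rotate (rotate (rotate h)))) s₄))

      module _ {a b : V} (fa : Far a) (fb : Far b) (ab : a ∼ b)
        (no-hole : ¬ ∃ λ j → Far j × (∃ λ c → Far c × a ∼ c × c ∼ j) × (∃ λ d → Far d × b ∼ d × d ∼ j)) where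

        -- Far vertices adjacent to neither `a` nor `b` form a stable set J, since an edge in J
        -- would give a 3K₂ with `a b` and `x y`. By `no-hole` a vertex of J cannot have far
        -- neighbours both in N(`a`) and in N(`b`), so it can join one of these two classes.
        data Bip (u : V) : Fin 4 → Set where
          P₀ : x ∼ u → Bip u 0F
          Q₁ : y ∼ u → Bip u 1F
          A₂ : Far u → a ∼ u → Bip u 2F
          J₂ : Far u → a ≁ u → b ≁ u → ¬ (∃ λ c → Far c × a ∼ c × c ∼ u) → Bip u 2F
          B₃ : Far u → b ∼ u → Bip u 3F
          J₃ : Far u → a ≁ u → b ≁ u → (∃ λ c → Far c × a ∼ c × c ∼ u) → Bip u 3F

        private
          J-J : ∀ {u v} → Far u → a ≁ u → b ≁ u → Far v → a ≁ v → b ≁ v → u ∼ v → ⊥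
          J-J {u} {v} (far xu yu) au bu (far xv yv) av bv uv =
            absurd forbidden x (y ∷ a ∷ b ∷ u ∷ v ∷ []) []
              (0 — 1 ∶ xy ⨾ 2 — 3 ∶ ab ⨾ 4 — 5 ∶ uv ⨾ 0 — 2 ∶ ≁x fa ⨾ 1 — 2 ∶ ≁y fa ⨾
                0 — 3 ∶ ≁x fb ⨾ 1 — 3 ∶ ≁y fb ⨾
               0 — 4 ∶ xu ⨾ 1 — 4 ∶ yu ⨾ 0 — 5 ∶ xv ⨾ 1 — 5 ∶ yv ⨾ 2 — 4 ∶ au ⨾ 3 — 4 ∶ bu ⨾
                 2 — 5 ∶ av ⨾ 3 — 5 ∶ bv ⨾ [])

        bip-clash : ∀ {u v k} → Bip u k → Bip v k → u ∼ v → ⊥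
        bip-clash (P₀ xu)   (P₀ xv)   uv = triangle xu xv uv
        bip-clash (Q₁ yu)   (Q₁ yv)   uv = triangle yu yv uv
        bip-clash (A₂ _ au) (A₂ _ av) uv = triangle au av uv
        bip-clash (A₂ fu au) (J₂ _ _ _ none) uv = none (_ , fu , au , uv)
        bip-clash (J₂ _ _ _ none) (A₂ fv av) uv = none (_ , fv , av , flip uv)
        bip-clash (J₂ fu au bu _) (J₂ fv av bv _) uv = J-J fu au bu fv av bv uv
        bip-clash (B₃ _ bu) (B₃ _ bv) uv = triangle bu bv uv
        bip-clash (B₃ fu bu) (J₃ fv _ _ c) uv = no-hole (_ , fv , c , _ , fu , bu , uv)
        bip-clash (J₃ fu _ _ c) (B₃ fv bv) uv = no-hole (_ , fu , c , _ , fv , bv , flip uv)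
        bip-clash (J₃ fu au bu _) (J₃ fv av bv _) uv = J-J fu au bu fv av bv uv

        bip-colour : ∀ u → ∃ (Bip u)
        bip-colour u with cases x u | cases y u | cases a u | cases b u
        ... | inj₁ xu | _       | _       | _       = _ , P₀ xu
        ... | inj₂ _  | inj₁ yu | _       | _       = _ , Q₁ yu
        ... | inj₂ xu | inj₂ yu | inj₁ au | _       = _ , A₂ (far xu yu) au
        ... | inj₂ xu | inj₂ yu | inj₂ _  | inj₁ bu = _ , B₃ (far xu yu) bu
        ... | inj₂ xu | inj₂ yu | inj₂ au | inj₂ bu with search (λ c → far? c ×-dec ∼? a c ×-dec ∼? c u)
        ...   | yes c = _ , J₃ (far xu yu) au bu c
        ...   | no n  = _ , J₂ (far xu yu) au bu n

      data Split (u : V) : Fin 4 → Set where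
        P₀ : x ∼ u → Split u 0F
        Q₁ : y ∼ u → Split u 1F
        R₂ : Far u → Split u 2F

      split-colour : ∀ u → ∃ (Split u)
      split-colour u with cases x u | cases y u
      ... | inj₁ xu | _       = _ , P₀ xu
      ... | inj₂ _  | inj₁ yu = _ , Q₁ yu
      ... | inj₂ xu | inj₂ yu = _ , R₂ (far xu yu)

      3K₂-free-4-colourable : 4Colourable
      3K₂-free-4-colourable with search (λ a → search λ b → far? a ×-dec far? b ×-dec ∼? a b)
      ... | no n = from-view Split split-colour split-clash
        where
        split-clash : ∀ {u v k} → Split u k → Split v k → u ∼ v → ⊥
        split-clash (P₀ xu) (P₀ xv) uv = triangle xu xv uv
        split-clash (Q₁ yu) (Q₁ yv) uv = triangle yu yv uv
        split-clash (R₂ fu) (R₂ fv) uv = n (_ , _ , fu , fv , uv)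
      ... | yes (a , b , fa , fb , ab)
        with search (λ j → far? j ×-dec (search λ c → far? c ×-dec ∼? a c ×-dec ∼? c j) ×-dec
                          (search λ d → far? d ×-dec ∼? b d ×-dec ∼? d j))
      ...   | no n = from-view (Bip fa fb ab n) (bip-colour fa fb ab n) (bip-clash fa fb ab n)
      ...   | yes (j , fj , (c , fc , ac , cj) , d , fd , bd , dj) =
        hole-4-colourable (hole fa fc fj fd fb ac cj (flip dj) (flip bd) (flip ab))

-- Colouring induced subgraphs

module _ {n : ℕ} (G : Graph n) where
  open import Data.List.Membership.DecPropositional (_≟_ {n}) using (_∈?_)

  private
    V = Fin n
    variable
      k l : ℕ
      xs ys : List V
      u v w : V

  infix 4 _∼_ _≁_
  _∼_ _≁_ : V → V → Set
  u ∼ v = adj G u v ≡ true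
  u ≁ v = adj G u v ≡ false

  _∼?_ : ∀ u v → Dec (u ∼ v)
  u ∼? v = adj G u v Bool.≟ true

  _≁?_ : ∀ u v → Dec (u ≁ v)
  u ≁? v = adj G u v Bool.≟ false

  ∼-sym : ∀ {u v b} → adj G u v ≡ b → adj G v u ≡ b
  ∼-sym = trans (Graph.sym G _ _)

  contra : u ∼ v → u ≁ v → ⊥
  contra p q with () ← trans (≡-sym p) q

  ∼⇒≢ : u ∼ v → u ≢ v
  ∼⇒≢ uv refl = contra uv (irrefl G _)

  -- The function is total with arbitrary values outside `xs`, so passing to a sublist leaves it
  -- unchanged.
  Col : List V → ℕ → Set
  Col xs k = Σ (V → ℕ) λ c → (∀ {u} → u ∈ xs → c u < k) ×
             (∀ {u v} → u ∈ xs → v ∈ xs → u ∼ v → c u ≢ c v)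

  Bound : List V → ℕ → Set
  Bound xs k = ∀ ks → AllPairs _∼_ ks → All (_∈ xs) ks → length ks ≤ k

  Col-⊆ : (∀ {u} → u ∈ xs → u ∈ ys) → Col ys k → Col xs k
  Col-⊆ sub (c , c< , proper) = c , c< ∘ sub , λ u∈ v∈ → proper (sub u∈) (sub v∈)

  Col-≤ : k ≤ l → Col xs k → Col xs l
  Col-≤ k≤l (c , c< , proper) = c , (λ u∈ → ≤-trans (c< u∈) k≤l) , proper

  Col-split : ∀ {P : V → Set} (P? : Decidable P) →
    Col (filter P? xs) k → Col (filter (¬? ∘ P?) xs) l → Col xs (k + l)
  Col-split {xs} {k} {l} P? (c , c< , c-proper) (d , d< , d-proper) = colour , bounded , proper
    where
    colour : V → ℕ
    colour u with P? u
    ... | yes _ = c u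
    ... | no  _ = k + d u
    bounded : u ∈ xs → colour u < k + l
    bounded {u} u∈ with P? u
    ... | yes p = <-≤-trans (c< (∈-filter⁺ P? u∈ p)) (m≤m+n k l)
    ... | no ¬p = +-monoʳ-< k (d< (∈-filter⁺ (¬? ∘ P?) u∈ ¬p))
    proper : u ∈ xs → v ∈ xs → u ∼ v → colour u ≢ colour v
    proper {u} {v} u∈ v∈ uv with P? u | P? v
    ... | yes p | yes q = c-proper (∈-filter⁺ P? u∈ p) (∈-filter⁺ P? v∈ q) uv
    ... | no ¬p | no ¬q =
      d-proper (∈-filter⁺ (¬? ∘ P?) u∈ ¬p) (∈-filter⁺ (¬? ∘ P?) v∈ ¬q) uv ∘ +-cancelˡ-≡ k _ _
    ... | yes p | no ¬q = λ eq → <-irrefl eq (<-≤-trans (c< (∈-filter⁺ P? u∈ p)) (m≤m+n k _))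
    ... | no ¬p | yes q = λ eq → <-irrefl (≡-sym eq) (<-≤-trans (c< (∈-filter⁺ P? v∈ q)) (m≤m+n k _))

  Col-edgeless : (∀ {u v} → u ∈ xs → v ∈ xs → u ∼ v → ⊥) → Col xs 1
  Col-edgeless edgeless = (λ _ → 0) , (λ _ → s≤s z≤n) , λ u∈ v∈ uv _ → edgeless u∈ v∈ uv

  Col-empty : Bound xs 0 → Col xs k
  Col-empty {xs} bound = (λ _ → 0) , (λ u∈ → ⊥-elim (empty u∈)) , λ u∈ → ⊥-elim (empty u∈)
    where
    empty : u ∈ xs → ⊥
    empty u∈ with () ← bound (_ ∷ []) ([] ∷ []) (u∈ ∷ [])

  -- A membership proof is a position in the list, so even predicates that depend on the proof range
  -- over finitely many cases.
  search : ∀ xs {P : Σ V (_∈ xs) → Set} → (∀ v → Dec (P v)) → Dec (∃ P)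
  search [] P? = no λ ()
  search (x ∷ xs) P? with P? (x , here refl)
  ... | yes p = yes (_ , p)
  ... | no ¬p = map′ (λ ((v , v∈) , p) → (v , there v∈) , p)
                     (λ { ((_ , here refl) , p) → contradiction p ¬p
                        ; ((v , there v∈) , p) → (v , v∈) , p })
                     (search xs λ (v , v∈) → P? (v , there v∈))

  -- Colouring P₄-free graphs

  P₄-free : List V → Set
  P₄-free xs = ∀ {a b c d} → a ∈ xs → b ∈ xs → c ∈ xs → d ∈ xs →
    a ∼ b → b ∼ c → c ∼ d → a ≁ c → a ≁ d → b ≁ d → ⊥

  record MaximalStable (xs M : List V) : Set where
    field
      ⊆xs      : u ∈ M → u ∈ xs
      stable   : u ∈ M → v ∈ M → u ≁ v
      dominate : u ∈ xs → u ∈ M ⊎ ∃ λ s → s ∈ M × u ∼ s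

  maximal-stable : ∀ xs → ∃ (MaximalStable xs)
  maximal-stable [] = [] , record { ⊆xs = λ () ; stable = λ () ; dominate = λ () }
  maximal-stable (x ∷ xs) with maximal-stable xs
  ... | M , max with any? (x ∼?_) M
  ...   | yes nbr = M , record
    { ⊆xs = there ∘ ⊆xs
    ; stable = stable
    ; dominate = λ { (here refl) → inj₂ (find nbr) ; (there u∈) → dominate u∈ } }
    where open MaximalStable max
  ...   | no none = x ∷ M , record
    { ⊆xs = λ { (here refl) → here refl ; (there u∈) → there (⊆xs u∈) }
    ; stable = λ { (here refl) (here refl) → irrefl G _
                 ; (here refl) (there v∈) → x≁ v∈
                 ; (there u∈) (here refl) → ∼-sym (x≁ u∈)
                 ; (there u∈) (there v∈) → stable u∈ v∈ }
    ; dominate = λ { (here refl) → inj₁ (here refl) ; (there u∈) → weaken (dominate u∈) } }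
    where
    open MaximalStable max
    x≁ : v ∈ M → x ≁ v
    x≁ v∈ = Bool.¬-not λ xv → none (lose v∈ xv)
    weaken : u ∈ M ⊎ (∃ λ s → s ∈ M × u ∼ s) → u ∈ x ∷ M ⊎ ∃ λ s → s ∈ x ∷ M × u ∼ s
    weaken (inj₁ u∈)            = inj₁ (there u∈)
    weaken (inj₂ (s , s∈ , us)) = inj₂ (s , there s∈ , us)

  -- If s is complete to ks but misses k, then any neighbour of k in the stable set is complete to
  -- k ∷ ks, for otherwise there is a P₄.
  complete-to-clique : ∀ {M} → P₄-free xs → MaximalStable xs M → ∀ k ks →
    All (_∈ xs) (k ∷ ks) → All (_∉ M) (k ∷ ks) → AllPairs _∼_ (k ∷ ks) →
    ∃ λ s → s ∈ M × All (s ∼_) (k ∷ ks)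
  complete-to-clique {xs} {M} P₄free max = go
    where
    open MaximalStable max
    nbr : ∀ {k} → k ∈ xs → k ∉ M → ∃ λ s → s ∈ M × s ∼ k
    nbr k∈ k∉ with dominate k∈
    ... | inj₁ k∈M            = contradiction k∈M k∉
    ... | inj₂ (s , s∈ , ks) = s , s∈ , ∼-sym ks
    go : ∀ k ks → All (_∈ xs) (k ∷ ks) → All (_∉ M) (k ∷ ks) → AllPairs _∼_ (k ∷ ks) →
         ∃ λ s → s ∈ M × All (s ∼_) (k ∷ ks)
    go k [] (k∈ ∷ []) (k∉ ∷ []) _ with nbr k∈ k∉
    ... | s , s∈ , sk = s , s∈ , sk ∷ []
    go k (k′ ∷ ks) (k∈ ∷ ks∈) (k∉ ∷ ks∉) (k∼ ∷ clique) with go k′ ks ks∈ ks∉ clique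
    ... | s , s∈ , s∼ with s ∼? k
    ...   | yes sk = s , s∈ , sk ∷ s∼
    ...   | no s≁k with nbr k∈ k∉
    ...     | r , r∈ , rk = r , r∈ , rk ∷ All.tabulate r∼
      where
      r∼ : ∀ {j} → j ∈ k′ ∷ ks → r ∼ j
      r∼ {j} j∈ with r ∼? j
      ... | yes rj = rj
      ... | no r≁j = ⊥-elim (P₄free (⊆xs s∈) (All.lookup ks∈ j∈) k∈ (⊆xs r∈)
        (All.lookup s∼ j∈) (∼-sym (All.lookup k∼ j∈)) (∼-sym rk)
        (Bool.¬-not s≁k) (stable s∈ r∈) (∼-sym (Bool.¬-not r≁j)))

  -- A clique that avoids a maximal stable set extends by a vertex of that set. Removing the set
  -- therefore costs one colour and lowers the clique bound by one.
  cograph-colouring : ∀ k xs → P₄-free xs → Bound xs k → Col xs k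
  cograph-colouring zero xs _ bound = Col-empty bound
  cograph-colouring (suc k) xs P₄free bound with maximal-stable xs
  ... | M , max = Col-split {k = 1} (_∈? M)
        (Col-edgeless λ u∈ v∈ uv → contra uv (stable (∈M u∈) (∈M v∈)))
        (cograph-colouring k rest (λ a b c d → P₄free (⊆ a) (⊆ b) (⊆ c) (⊆ d)) bound′)
    where
    open MaximalStable max
    ∈M : u ∈ filter (_∈? M) xs → u ∈ M
    ∈M = proj₂ ∘ ∈-filter⁻ (_∈? M) {xs = xs}
    rest : List V
    rest = filter (¬? ∘ (_∈? M)) xs
    ⊆ : u ∈ rest → u ∈ xs
    ⊆ = proj₁ ∘ ∈-filter⁻ (¬? ∘ (_∈? M)) {xs = xs}
    bound′ : Bound rest k
    bound′ [] _ _ = z≤n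
    bound′ (j ∷ js) clique js∈
      with s , s∈ , s∼ ← complete-to-clique P₄free max j js (All.map ⊆ js∈)
                           (All.map (proj₂ ∘ ∈-filter⁻ (¬? ∘ (_∈? M)) {xs = xs}) js∈) clique
      with s≤s le ← bound (s ∷ j ∷ js) (s∼ ∷ clique) (⊆xs s∈ ∷ All.map ⊆ js∈) = le

  Gem-free : Set
  Gem-free = ∀ {z a b c d} → z ∼ a → z ∼ b → z ∼ c → z ∼ d →
    a ∼ b → b ∼ c → c ∼ d → a ≁ c → a ≁ d → b ≁ d → ⊥

  nbhd : V → List V → List V
  nbhd x = filter (x ∼?_)

  nbhd-colouring : Gem-free → ∀ {x} → x ∈ xs → Bound xs (suc k) → Col (nbhd x xs) k
  nbhd-colouring {xs} {k} gem-free {x} x∈ bound = cograph-colouring k (nbhd x xs)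
    (λ a b c d → gem-free (x∼ a) (x∼ b) (x∼ c) (x∼ d)) bound′
    where
    x∼ : u ∈ nbhd x xs → x ∼ u
    x∼ = proj₂ ∘ ∈-filter⁻ (x ∼?_) {xs = xs}
    bound′ : Bound (nbhd x xs) k
    bound′ js clique js∈
      with s≤s le ← bound (x ∷ js) (All.map x∼ js∈ ∷ clique)
                      (x∈ ∷ All.map (proj₁ ∘ ∈-filter⁻ (x ∼?_) {xs = xs}) js∈) = le

  module On (xs : List V) where
    W : Set
    W = Σ V (_∈ xs)

    e : W → W → Bool
    e (u , _) (v , _) = adj G u v

    e-sym : ∀ u v → e u v ≡ e v u
    e-sym (u , _) (v , _) = Graph.sym G u v

    from-W : (c : W → Fin k) → (∀ u v → e u v ≡ true → c u ≢ c v) → Col xs k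
    from-W {zero} c _ = (λ _ → 0) , (λ u∈ → ⊥-elim (empty u∈)) , λ u∈ → ⊥-elim (empty u∈)
      where
      empty : u ∈ xs → ⊥
      empty u∈ with () ← c (_ , u∈)
    from-W {suc k} c c-proper = colour , bounded , proper
      where
      colour : V → ℕ
      colour u with u ∈? xs
      -- If `u` is listed several times, the occurrence found by `_∈?_` decides its colour.
      ... | yes u∈ = toℕ (c (u , u∈))
      ... | no _   = 0
      bounded : u ∈ xs → colour u < suc k
      bounded {u} _ with u ∈? xs
      ... | yes u∈ = toℕ<n (c (u , u∈))
      ... | no _   = s≤s z≤n
      proper : u ∈ xs → v ∈ xs → u ∼ v → colour u ≢ colour v
      proper {u} {v} u∈ v∈ uv with u ∈? xs | v ∈? xs
      ... | yes p | yes q = c-proper (u , p) (v , q) uv ∘ toℕ-injective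
      ... | no u∉ | _     = contradiction u∈ u∉
      ... | _     | no v∉ = contradiction v∈ v∉

  -- The case p = 2, ω ≥ 3

  2K₂-free : List V → Set
  2K₂-free xs = ∀ {a b c d} → a ∈ xs → b ∈ xs → c ∈ xs → d ∈ xs →
    a ∼ b → c ∼ d → a ≁ c → a ≁ d → b ≁ c → b ≁ d → ⊥

  Comparable : List V → V → V → Set
  Comparable xs u v = u ≢ v × u ≁ v × All (λ t → t ∼ u → t ∼ v) xs

  delete : V → List V → List V
  delete u = filter (λ t → ¬? (t ≟ u))

  Col-comparable : u ∈ xs → v ∈ xs → Comparable xs u v → Col (delete u xs) k → Col xs k
  Col-comparable {u} {xs} {v} {k} u∈ v∈ (u≢v , u≁v , N⊆) (c , c< , c-proper) = colour , bounded , proper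
    where
    kept : ∀ {t} → t ∈ xs → t ≢ u → t ∈ delete u xs
    kept = ∈-filter⁺ (λ t → ¬? (t ≟ u))
    v∈′ : v ∈ delete u xs
    v∈′ = kept v∈ (u≢v ∘ ≡-sym)
    colour : V → ℕ
    colour t with t ≟ u
    ... | yes _ = c v
    ... | no _  = c t
    bounded : ∀ {t} → t ∈ xs → colour t < k
    bounded {t} t∈ with t ≟ u
    ... | yes _  = c< v∈′
    ... | no t≢u = c< (kept t∈ t≢u)
    proper : ∀ {s t} → s ∈ xs → t ∈ xs → s ∼ t → colour s ≢ colour t
    proper {s} {t} s∈ t∈ st with s ≟ u | t ≟ u
    ... | yes refl | yes refl = λ _ → contra st (irrefl G u)
    ... | yes refl | no t≢u   = λ eq → c-proper (kept t∈ t≢u) v∈′ (All.lookup N⊆ t∈ (∼-sym st)) (≡-sym eq)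
    ... | no s≢u   | yes refl = c-proper (kept s∈ s≢u) v∈′ (All.lookup N⊆ s∈ st)
    ... | no s≢u   | no t≢u   = c-proper (kept s∈ s≢u) (kept t∈ t≢u) st

  Col-universal : Gem-free → ∀ {x} → x ∈ xs → (∀ {u} → u ∈ xs → u ≢ x → x ∼ u) →
    Bound xs (suc k) → Col xs (suc k)
  Col-universal {xs} gem-free {x} x∈ universal bound =
    Col-split {k = 1} (_≟ x)
      (Col-edgeless λ u∈ v∈ uv → ∼⇒≢ uv (trans (is-x u∈) (≡-sym (is-x v∈))))
      (Col-⊆ (λ u∈ → let (u∈xs , u≢x) = ∈-filter⁻ (¬? ∘ (_≟ x)) {xs = xs} u∈ in
                      ∈-filter⁺ (x ∼?_) u∈xs (universal u∈xs u≢x))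
             (nbhd-colouring gem-free x∈ bound))
    where
    is-x : u ∈ filter (_≟ x) xs → u ≡ x
    is-x = proj₂ ∘ ∈-filter⁻ (_≟ x) {xs = xs}

  2K₂-gem-free-colouring : Gem-free → ∀ {k} xs → 2K₂-free xs → Bound xs (3 + k) → Col xs (3 + k)
  2K₂-gem-free-colouring gem-free {k} xs = go xs (<-wellFounded _)
    where
    comparable? : ∀ xs u v → Dec (Comparable xs u v)
    comparable? xs u v = ¬? (u ≟ v) ×-dec u ≁? v ×-dec all? (λ t → (t ∼? u) →-dec (t ∼? v)) xs
    go : ∀ xs → Acc _<_ (length xs) → 2K₂-free xs → Bound xs (3 + k) → Col xs (3 + k)
    go [] _ _ _ = (λ _ → 0) , (λ ()) , λ ()
    go xs@(x ∷ _) (acc smaller) 2K₂free bound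
      with search xs (λ (u , _) → search xs (λ (v , _) → comparable? xs u v))
    ... | yes ((u , u∈) , (v , v∈) , cmp) = Col-comparable u∈ v∈ cmp
          (go (delete u xs) (smaller (filter-notAll (λ t → ¬? (t ≟ u)) xs (lose u∈ (λ ¬p → ¬p refl))))
              (λ a b c d → 2K₂free (⊆ a) (⊆ b) (⊆ c) (⊆ d))
              (λ js clique js∈ → bound js clique (All.map ⊆ js∈)))
      where
      ⊆ : ∀ {t} → t ∈ delete u xs → t ∈ xs
      ⊆ = proj₁ ∘ ∈-filter⁻ (λ t → ¬? (t ≟ u)) {xs = xs}
    -- Any vertex will do here, so the head of the list is tested for being universal.
    ... | no incomparable with search xs (λ (v , _) → ¬? (v ≟ x) ×-dec x ≁? v)
    ...   | no universal = Col-universal gem-free (here refl)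
            (λ u∈ u≢x → Bool.¬-not λ x≁u → universal ((_ , u∈) , u≢x , x≁u)) bound
    ...   | yes ((y , y∈) , y≢x , xy) =
      Col-≤ (s≤s (s≤s (s≤s z≤n))) (from-W (proj₁ col) (proj₂ col))
      where
      open On xs
      separated : ∀ {u v} → u ∈ xs → v ∈ xs → u ≢ v → u ≁ v → ∃ λ (r : W) → proj₁ r ∼ v × proj₁ r ≁ u
      separated {u} {v} u∈ v∈ u≢v uv with search xs (λ (r , _) → r ∼? v ×-dec r ≁? u)
      ... | yes r = r
      ... | no none = ⊥-elim (incomparable ((v , v∈) , (u , u∈) , u≢v ∘ ≡-sym , ∼-sym uv ,
              All.tabulate λ r∈ rv → Bool.¬-not λ ru → none ((_ , r∈) , rv , ru)))
      open Hexagon e e-sym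
      open Pentagon e e-sym
      col : 3Colourable
      col with separated (here refl) y∈ (y≢x ∘ ≡-sym) xy | separated y∈ (here refl) y≢x (∼-sym xy)
      -- In the complement `a x y d` is a path with middle edge `x y`. It is induced, for otherwise
      -- `a y` and `d x` form a 2K₂.
      ... | a , ay , ax | d , dx , dy = reduced-3-colourable
        (λ ((a , a∈) , _ , (b , b∈) , (ba , _) , (c , c∈) , (cb , ca , _) , (d , d∈) , (dc , db , da , _) , _) →
          2K₂free a∈ b∈ c∈ d∈ (∼-sym ba) (∼-sym dc) (∼-sym ca) (∼-sym da) (∼-sym cb) (∼-sym db))
        (λ ((z , _) , _ , (a , _) , (az , _) , (b , _) , (ba , bz , _) , (c , _) , (cb , ca , cz , _) ,
            (d , _) , (dc , db , da , dz , _) , _) →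
          gem-free (∼-sym az) (∼-sym bz) (∼-sym cz) (∼-sym dz) (∼-sym ba) (∼-sym cb) (∼-sym dc)
                   (∼-sym ca) (∼-sym da) (∼-sym db))
        (search xs)
        (λ (u , u∈) (v , v∈) s uv su sv → separated u∈ v∈ (λ { refl → contra su sv }) uv)
        {a = a} {b = x , here refl} {c = y , y∈} {d = d} xy ax ay dx dy

  -- The recursion on p

  remote : V → V → List V → List V
  remote x y xs = filter (¬? ∘ (y ∼?_)) (filter (¬? ∘ (x ∼?_)) xs)

  ∈-remote⁺ : ∀ {x y} → u ∈ xs → x ≁ u → y ≁ u → u ∈ remote x y xs
  ∈-remote⁺ {x = x} {y} u∈ xu yu =
    ∈-filter⁺ (¬? ∘ (y ∼?_)) (∈-filter⁺ (¬? ∘ (x ∼?_)) u∈ (λ p → contra p xu)) (λ p → contra p yu)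

  ∈-remote⁻ : ∀ x y xs {u} → u ∈ remote x y xs → u ∈ xs × x ≁ u × y ≁ u
  ∈-remote⁻ x y xs u∈
    with u∈′ , ¬yu ← ∈-filter⁻ (¬? ∘ (y ∼?_)) {xs = filter (¬? ∘ (x ∼?_)) xs} u∈
    with u∈xs , ¬xu ← ∈-filter⁻ (¬? ∘ (x ∼?_)) {xs = xs} u∈′ = u∈xs , Bool.¬-not ¬xu , Bool.¬-not ¬yu

  -- An induced pK₂, peeled off edge by edge so that its absence passes to `remote x y xs`.
  Matching : ℕ → List V → Set
  Matching zero    xs = ⊤
  Matching (suc p) xs = ∃ λ x → ∃ λ y → x ∈ xs × y ∈ xs × x ∼ y × Matching p (remote x y xs)

  edge? : ∀ xs → (∃ λ x → ∃ λ y → x ∈ xs × y ∈ xs × x ∼ y) ⊎ (∀ {x y} → x ∈ xs → y ∈ xs → x ∼ y → ⊥)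
  edge? xs with search xs (λ (x , _) → search xs λ (y , _) → x ∼? y)
  ... | yes ((x , x∈) , (y , y∈) , xy) = inj₁ (x , y , x∈ , y∈ , xy)
  ... | no none                        = inj₂ λ x∈ y∈ xy → none ((_ , x∈) , (_ , y∈) , xy)

  -- With ω ≤ 2 + `k`, the two summands `suc k` are the ω - 1 colours for N(`x`) and for the part of
  -- N(`y`) outside N(`x`).
  edge-step : ∀ {p} → Gem-free → (∀ ys → ¬ Matching p ys → Bound ys (2 + k) → Col ys l) →
    ∀ xs → ¬ Matching (suc p) xs → Bound xs (2 + k) → Col xs (suc k + (suc k + l))
  edge-step gem-free col xs unmatched bound with edge? xs
  ... | inj₂ edgeless = Col-≤ (s≤s z≤n) (Col-edgeless edgeless)
  ... | inj₁ (x , y , x∈ , y∈ , xy) =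
    Col-split (x ∼?_) (nbhd-colouring gem-free x∈ bound)
      (Col-split (y ∼?_) (Col-⊆ ⊆ (nbhd-colouring gem-free y∈ bound))
        (col (remote x y xs) (λ M → unmatched (x , y , x∈ , y∈ , xy , M))
             (λ js clique js∈ → bound js clique (All.map (proj₁ ∘ ∈-remote⁻ x y xs) js∈))))
    where
    ⊆ : u ∈ filter (y ∼?_) (filter (¬? ∘ (x ∼?_)) xs) → u ∈ filter (y ∼?_) xs
    ⊆ u∈ with u∈′ , yu ← ∈-filter⁻ (y ∼?_) {xs = filter (¬? ∘ (x ∼?_)) xs} u∈ =
      ∈-filter⁺ (y ∼?_) (proj₁ (∈-filter⁻ (¬? ∘ (x ∼?_)) {xs = xs} u∈′)) yu

  triangle-free-colouring : ∀ xs → ¬ Matching 3 xs → Bound xs 2 → Col xs 4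
  triangle-free-colouring xs unmatched bound with edge? xs
  ... | inj₂ edgeless = Col-≤ (s≤s z≤n) (Col-edgeless edgeless)
  ... | inj₁ (x , y , x∈ , y∈ , xy) = from-W (proj₁ col) (proj₂ col)
    where
    open On xs
    open TriangleFree e e-sym
    K₃-free : ¬ _
    K₃-free ((a , a∈) , _ , (b , b∈) , (ba , _) , (c , c∈) , (cb , ca , _) , _)
      with s≤s (s≤s ()) ← bound (c ∷ b ∷ a ∷ []) ((cb ∷ ca ∷ []) ∷ (ba ∷ []) ∷ [] ∷ []) (c∈ ∷ b∈ ∷ a∈ ∷ [])
    3K₂-free : ¬ _
    3K₂-free ((a , a∈) , _ , (b , b∈) , (ba , _) , (c , c∈) , (cb , ca , _) , (d , d∈) , (dc , db , da , _) ,
              (g , g∈) , (gd , gc , gb , ga , _) , (h , h∈) , (hg , hd , hc , hb , ha , _) , _) =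
      unmatched (a , b , a∈ , b∈ , ∼-sym ba ,
                 c , d , ∈-remote⁺ c∈ (∼-sym ca) (∼-sym cb) , ∈-remote⁺ d∈ (∼-sym da) (∼-sym db) , ∼-sym dc ,
                 g , h , ∈-remote⁺ (∈-remote⁺ g∈ (∼-sym ga) (∼-sym gb)) (∼-sym gc) (∼-sym gd) ,
                         ∈-remote⁺ (∈-remote⁺ h∈ (∼-sym ha) (∼-sym hb)) (∼-sym hc) (∼-sym hd) , ∼-sym hg , _)
    col = 3K₂-free-4-colourable K₃-free 3K₂-free {x , x∈} {y , y∈} xy (search xs)

  2*-∸2 : ∀ m → 2 * suc m ∸ 2 ≡ m + m
  2*-∸2 m rewrite +-identityʳ m | +-suc m m = refl

  colouring : Gem-free → ∀ p m xs → ¬ Matching (2 + p) xs → Bound xs m → Col xs (f (2 + p) m)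
  colouring gem-free p 0 xs _ bound = Col-empty bound
  colouring gem-free p 1 xs _ bound = Col-edgeless edgeless
    where
    edgeless : u ∈ xs → v ∈ xs → u ∼ v → ⊥
    edgeless u∈ v∈ uv with s≤s () ← bound (_ ∷ _ ∷ []) ((uv ∷ []) ∷ [] ∷ []) (u∈ ∷ v∈ ∷ [])
  -- The argument `p` is offset by two. For 2K₂ the vertices remote from an edge span no edge, which
  -- gives 1 + 1 + 1 colours.
  colouring gem-free 0 2 xs unmatched bound = edge-step gem-free
    (λ ys unmatched _ → Col-edgeless λ u∈ v∈ uv → unmatched (_ , _ , u∈ , v∈ , uv , _)) xs unmatched bound
  colouring gem-free 1 2 xs unmatched bound = triangle-free-colouring xs unmatched bound
  -- From 4K₂ on, each step adds two colours to the value 4 reached for 3K₂.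
  colouring gem-free (suc (suc p)) 2 xs unmatched bound =
    subst (Col xs) eq (edge-step gem-free (colouring gem-free (suc p) 2) xs unmatched bound)
    where
    eq : 2 + (2 * (3 + p) ∸ 2) ≡ 2 * (4 + p) ∸ 2
    eq rewrite 2*-∸2 (2 + p) | 2*-∸2 (3 + p) | +-suc (2 + p) (2 + p) = refl
  colouring gem-free 0 (suc (suc (suc m))) xs unmatched bound = 2K₂-gem-free-colouring gem-free xs
    (λ a∈ b∈ c∈ d∈ ab cd ac ad bc bd → unmatched
      (_ , _ , a∈ , b∈ , ab , _ , _ , ∈-remote⁺ c∈ ac bc , ∈-remote⁺ d∈ ad bd , cd , _)) bound
  colouring gem-free (suc p) (suc (suc (suc m))) xs unmatched bound =
    subst (Col xs) eq (edge-step gem-free (colouring gem-free p (3 + m)) xs unmatched bound)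
    where
    eq : (2 + m) + ((2 + m) + f (2 + p) (3 + m)) ≡ f (2 + p) (3 + m) + (2 * (3 + m) ∸ 2)
    eq = trans (≡-sym (+-assoc (2 + m) (2 + m) (f (2 + p) (3 + m))))
         (trans (+-comm ((2 + m) + (2 + m)) (f (2 + p) (3 + m)))
                (cong (f (2 + p) (3 + m) +_) (≡-sym (2*-∸2 (2 + m)))))

  -- Translation of the hypotheses

  gem-free⁺ : ¬ ContainsInduced G 5 gem → Gem-free
  gem-free⁺ free {z} {a} {b} {c} {d} za zb zc zd ab bc cd ac ad bd = free (φ , injective , matches)
    where
    φ : Fin 5 → V
    φ 0F = a
    φ 1F = b
    φ 2F = c
    φ 3F = d
    φ 4F = z

    φ-adj : Fin 5 → Fin 5 → Bool
    φ-adj i j = adj G (φ i) (φ j)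

    above : ∀ i j → toℕ i < toℕ j → gem i j ≡ φ-adj i j
    above 0F 1F _ = ≡-sym ab
    above 0F 2F _ = ≡-sym ac
    above 0F 3F _ = ≡-sym ad
    above 0F 4F _ = ≡-sym (∼-sym za)
    above 1F 2F _ = ≡-sym bc
    above 1F 3F _ = ≡-sym bd
    above 1F 4F _ = ≡-sym (∼-sym zb)
    above 2F 3F _ = ≡-sym cd
    above 2F 4F _ = ≡-sym (∼-sym zc)
    above 3F 4F _ = ≡-sym (∼-sym zd)
    above (suc _) 0F ()
    above (suc (suc _)) 1F (s≤s ())
    above 1F 1F (s≤s ())
    above 2F 2F (s≤s (s≤s ()))
    above (suc (suc (suc _))) 2F (s≤s (s≤s ()))
    above 3F 3F (s≤s (s≤s (s≤s ())))
    above 4F 3F (s≤s (s≤s (s≤s ())))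
    above 4F 4F (s≤s (s≤s (s≤s (s≤s ()))))

    gem-sym : ∀ i j → gem i j ≡ gem j i
    gem-sym = toWitness {a? = Fin.all? λ i → Fin.all? λ j → gem i j Bool.≟ gem j i} _

    gem-irrefl : ∀ i → gem i i ≡ false
    gem-irrefl = toWitness {a? = Fin.all? λ i → gem i i Bool.≟ false} _

    matches : ∀ i j → gem i j ≡ φ-adj i j
    matches i j with <-cmp (toℕ i) (toℕ j)
    ... | tri< i<j _ _ = above i j i<j
    ... | tri> _ _ j<i = trans (gem-sym i j) (trans (above j i j<i) (Graph.sym G _ _))
    ... | tri≈ _ i≡j _ with refl ← toℕ-injective i≡j = trans (gem-irrefl i) (≡-sym (irrefl G _))

    -- This turns injectivity of `φ` into a consequence of `matches`.
    rows : ∀ i j → (∀ k → gem i k ≡ gem j k) → i ≡ j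
    rows = toWitness {a? = Fin.all? λ i → Fin.all? λ j →
      Fin.all? (λ k → gem i k Bool.≟ gem j k) →-dec (i ≟ j)} _

    injective : ∀ {i j} → φ i ≡ φ j → i ≡ j
    injective {i} {j} eq = rows i j λ k →
      trans (matches i k) (trans (cong (λ u → adj G u (φ k)) eq) (≡-sym (matches j k)))

  matching-embedding : ∀ p {xs} → Matching p xs → Σ (Fin (p * 2) → V) λ φ →
    (∀ i → φ i ∈ xs) × Injective _≡_ _≡_ φ × (∀ i j → pK₂ p i j ≡ adj G (φ i) (φ j))
  matching-embedding zero _ = (λ ()) , (λ ()) , (λ { {()} }) , λ ()
  matching-embedding (suc p) {xs} (x , y , x∈ , y∈ , xy , M) with matching-embedding p M
  ... | φ , φ∈ , φ-injective , φ-matches = ψ , ψ∈ , injective , matches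
    where
    remote∈ : ∀ i → φ i ∈ xs × x ≁ φ i × y ≁ φ i
    remote∈ i = ∈-remote⁻ x y xs (φ∈ i)

    ψ : Fin (suc p * 2) → V
    ψ zero          = x
    ψ (suc zero)    = y
    ψ (suc (suc i)) = φ i

    ψ∈ : ∀ i → ψ i ∈ xs
    ψ∈ zero          = x∈
    ψ∈ (suc zero)    = y∈
    ψ∈ (suc (suc i)) = proj₁ (remote∈ i)

    -- The vertex `y` is adjacent to `x` but not to `φ i`.
    x≢ : ∀ i → x ≢ φ i
    x≢ i eq = contra (subst (y ∼_) eq (∼-sym xy)) (proj₂ (proj₂ (remote∈ i)))

    y≢ : ∀ i → y ≢ φ i
    y≢ i eq = contra (subst (x ∼_) eq xy) (proj₁ (proj₂ (remote∈ i)))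

    injective : Injective _≡_ _≡_ ψ
    injective {zero}        {zero}        _  = refl
    injective {zero}        {suc zero}    eq = contradiction eq (∼⇒≢ xy)
    injective {zero}        {suc (suc j)} eq = contradiction eq (x≢ j)
    injective {suc zero}    {zero}        eq = contradiction (≡-sym eq) (∼⇒≢ xy)
    injective {suc zero}    {suc zero}    _  = refl
    injective {suc zero}    {suc (suc j)} eq = contradiction eq (y≢ j)
    injective {suc (suc i)} {zero}        eq = contradiction (≡-sym eq) (x≢ i)
    injective {suc (suc i)} {suc zero}    eq = contradiction (≡-sym eq) (y≢ i)
    injective {suc (suc i)} {suc (suc j)} eq = cong (λ k → suc (suc k)) (φ-injective eq)

    -- Shifting an index by two moves it to the next edge of pK₂, which reduces the shifted indices
    -- to the smaller matching.
    half : ∀ m → (2 + m) / 2 ≡ suc (m / 2)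
    half m = m/n≡1+[m∸n]/n {2 + m} {2} (s≤s (s≤s z≤n))

    matches : ∀ i j → pK₂ (suc p) i j ≡ adj G (ψ i) (ψ j)
    matches zero          zero          = ≡-sym (irrefl G x)
    matches zero          (suc zero)    = ≡-sym xy
    matches zero          (suc (suc j)) rewrite half (toℕ j) = ≡-sym (proj₁ (proj₂ (remote∈ j)))
    matches (suc zero)    zero          = ≡-sym (∼-sym xy)
    matches (suc zero)    (suc zero)    = ≡-sym (irrefl G y)
    matches (suc zero)    (suc (suc j)) rewrite half (toℕ j) = ≡-sym (proj₂ (proj₂ (remote∈ j)))
    matches (suc (suc i)) zero          rewrite half (toℕ i) = ≡-sym (∼-sym (proj₁ (proj₂ (remote∈ i))))
    matches (suc (suc i)) (suc zero)    rewrite half (toℕ i) = ≡-sym (∼-sym (proj₂ (proj₂ (remote∈ i))))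
    matches (suc (suc i)) (suc (suc j)) with i ≟ j | φ-matches i j
    ... | yes _ | match = match
    ... | no _  | match rewrite half (toℕ i) | half (toℕ j) = match

  Bound⁺ : ∀ {w} → (∀ k → Clique G k → k ≤ w) → Bound xs w
  Bound⁺ maximal js clique _ = maximal (length js) (lookup js , injective , adjacent clique)
    where
    adjacent : ∀ {js} → AllPairs _∼_ js → ∀ i j → i ≢ j → lookup js i ∼ lookup js j
    adjacent (_  ∷ _)      zero    zero    i≢j = contradiction refl i≢j
    adjacent (j∼ ∷ _)      zero    (suc j) _   = All.lookup j∼ (∈-lookup j)
    adjacent (j∼ ∷ _)      (suc i) zero    _   = ∼-sym (All.lookup j∼ (∈-lookup i))
    adjacent (_  ∷ clique) (suc i) (suc j) i≢j = adjacent clique i j (i≢j ∘ cong suc)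

    injective : Injective _≡_ _≡_ (lookup js)
    injective {i} {j} eq with i ≟ j
    ... | yes i≡j = i≡j
    ... | no i≢j  = contradiction eq (∼⇒≢ (adjacent clique i j i≢j))

theorem3p3 : (p : ℕ) → 2 ≤ p → (n : ℕ) → (G : Graph n) → PK₂GemFree p G →
    (w : ℕ) → IsCliqueNumber G w → Colourable G (f p w)
theorem3p3 (suc (suc p)) (s≤s (s≤s _)) n G (pK₂-free , gem-free) w (_ , maximal)
  with c , c< , proper ← colouring G (gem-free⁺ G gem-free) p w (allFin n)
         (λ M → let (φ , _ , injective , matches) = matching-embedding G (2 + p) M in
                pK₂-free (φ , injective , matches))
         (Bound⁺ G maximal) =
  (λ u → fromℕ< (c< (∈-allFin u))) ,
  λ u v uv eq → proper (∈-allFin u) (∈-allFin v) uv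
    (trans (≡-sym (toℕ-fromℕ< _)) (trans (cong toℕ eq) (toℕ-fromℕ< _)))
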